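{- The following eight mesh patterns $(12,R)$ are pairwise equidistributed, where $R$ ranges over: $\{(1,2),(2,2),(0,1),(1,1),(2,1),(0,0)\}$, $\{(1,2),(2,2),(0,1),(1,1),(0,0),(1,0)\}$, $\{(1,2),(2,2),(1,1),(2,1),(0,0),(1,0)\}$, $\{(2,2),(0,1),(1,1),(2,1),(0,0),(1,0)\}$, $\{(0,2),(2,2),(0,1),(1,1),(2,1),(1,0)\}$, $\{(0,2),(1,2),(1,1),(2,1),(0,0),(1,0)\}$, $\{(1,2),(0,1),(1,1),(2,1),(0,0),(2,0)\}$, $\{(1,2),(2,2),(0,1),(1,1),(1,0),(2,0)\}$. Moreover, for each such pattern $p$, with $F(x)=\sum_{n\ge0}n!x^n$, $A(x)=\sum_{n\ge0}s_{n,0}(p)x^n$ and $F(x,q)=\sum_{n\ge0}x^n\sum_{\pi\in S_n}q^{p(\pi)}$, $$A(x)=\frac{F(x)}{1+x(F(x)-1)},\qquad F(x,q)=\frac{F(x)}{1+(1-q)x(F(x)-1)}.$$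
   Context: For $R\subseteq\{0,1,2\}^2$ and $\pi=\pi_1\cdots\pi_n\in S_n$, an occurrence of the mesh pattern $(12,R)$ in $\pi$ is a pair of positions $i_1<i_2$ with $\pi_{i_1}<\pi_{i_2}$ such that, setting $x_0=0,x_1=i_1,x_2=i_2,x_3=n+1$ and $y_0=0,y_1=\pi_{i_1},y_2=\pi_{i_2},y_3=n+1$, for every $(a,b)\in R$ there is no index $k$ with $x_a<k<x_{a+1}$ and $y_b<\pi_k<y_{b+1}$. $p(\pi)$ is the number of occurrences of $p$ in $\pi$; $s_{n,k}(p)$ the number of $\pi\in S_n$ with $p(\pi)=k$; $p_1,p_2$ are equidistributed if $s_{n,k}(p_1)=s_{n,k}(p_2)$ for all $n,k\ge 0$. Generating functions are formal power series. -}

module Defs where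

open import Data.Bool using (Bool; true; false; _∧_; _∨_; not; if_then_else_)
open import Data.Nat using (ℕ; zero; suc; _+_; _∸_; _<ᵇ_; _≡ᵇ_; _!)

open import Data.Integer using (ℤ; +_; -_) renaming (_+_ to _+ℤ_; _*_ to _*ℤ_)
open import Data.Fin using (Fin; toℕ) renaming (zero to f0; suc to fs)
open import Data.List using (List; []; _∷_; map; concatMap; length; filterᵇ; cartesianProduct; allFin)
open import Data.Bool.ListAction using (all; any)
open import Data.Vec using (Vec; []; _∷_; lookup; toList)
open import Data.Product using (_×_; _,_)
open import Relation.Binary.PropositionalEquality using (_≡_)

-- Permutations of [n] = {1,…,n}.  A permutation π₁⋯πₙ is encoded as a
-- vector of length n over Fin n (value v : Fin n stands for toℕ v + 1,
-- position i : Fin n stands for toℕ i + 1) with pairwise distinct entries.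

vecs : {A : Set} → List A → (m : ℕ) → List (Vec A m)
vecs xs zero    = [] ∷ []
vecs xs (suc m) = concatMap (λ x → map (x ∷_) (vecs xs m)) xs

distinct : {n : ℕ} → List (Fin n) → Bool
distinct []       = true
distinct (x ∷ xs) = not (any (λ y → toℕ x ≡ᵇ toℕ y) xs) ∧ distinct xs

Sn : (n : ℕ) → List (Vec (Fin n) n)
Sn n = filterᵇ (λ v → distinct (toList v)) (vecs (allFin n) n)

MeshSet : Set
MeshSet = List (Fin 3 × Fin 3)

lower : ℕ → ℕ → ℕ → Fin 3 → ℕ
lower n u₁ u₂ f0           = 0
lower n u₁ u₂ (fs f0)      = u₁
lower n u₁ u₂ (fs (fs f0)) = u₂

upper : ℕ → ℕ → ℕ → Fin 3 → ℕ
upper n u₁ u₂ f0           = u₁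
upper n u₁ u₂ (fs f0)      = u₂
upper n u₁ u₂ (fs (fs f0)) = suc n

strictlyBetween : ℕ → ℕ → ℕ → Bool
strictlyBetween lo z hi = (lo <ᵇ z) ∧ (z <ᵇ hi)

isOcc : {n : ℕ} → MeshSet → Vec (Fin n) n → Fin n → Fin n → Bool
isOcc {n} R π i₁ i₂ =
  (x₁ <ᵇ x₂) ∧ (y₁ <ᵇ y₂) ∧
  all (λ { (a , b) → not (any (λ k →
          strictlyBetween (lower n x₁ x₂ a) (suc (toℕ k)) (upper n x₁ x₂ a) ∧
          strictlyBetween (lower n y₁ y₂ b) (suc (toℕ (lookup π k))) (upper n y₁ y₂ b))
        (allFin n)) }) R
  where
  x₁ = suc (toℕ i₁)
  x₂ = suc (toℕ i₂)
  y₁ = suc (toℕ (lookup π i₁))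
  y₂ = suc (toℕ (lookup π i₂))

occurrences : {n : ℕ} → MeshSet → Vec (Fin n) n → ℕ
occurrences {n} R π =
  length (filterᵇ (λ { (i₁ , i₂) → isOcc R π i₁ i₂ }) (cartesianProduct (allFin n) (allFin n)))

s : MeshSet → ℕ → ℕ → ℕ
s R n k = length (filterᵇ (λ π → occurrences R π ≡ᵇ k) (Sn n))

Equidistributed : MeshSet → MeshSet → Set
Equidistributed R₁ R₂ = (n k : ℕ) → s R₁ n k ≡ s R₂ n k

-- Formal power series with integer coefficients.
-- Univariate series in x: coefficient sequences ℕ → ℤ.
-- Bivariate series in x, q: (n k : ℕ) ↦ coefficient of xⁿ qᵏ.

PS : Set
PS = ℕ → ℤ

PS₂ : Set
PS₂ = ℕ → ℕ → ℤ

sumTo : ℕ → (ℕ → ℤ) → ℤ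
sumTo zero    f = f 0
sumTo (suc n) f = sumTo n f +ℤ f (suc n)

_⊕_ : PS → PS → PS
(f ⊕ g) n = f n +ℤ g n

_⊗_ : PS → PS → PS
(f ⊗ g) n = sumTo n (λ i → f i *ℤ g (n ∸ i))

_⊕₂_ : PS₂ → PS₂ → PS₂
(f ⊕₂ g) n k = f n k +ℤ g n k

_⊗₂_ : PS₂ → PS₂ → PS₂
(f ⊗₂ g) n k = sumTo n (λ i → sumTo k (λ j → f i j *ℤ g (n ∸ i) (k ∸ j)))

lift : PS → PS₂
lift f n zero    = f n
lift f n (suc k) = + 0

one : PS
one zero    = + 1
one (suc n) = + 0

X : PS
X (suc zero) = + 1
X _          = + 0

Q : PS₂
Q zero (suc zero) = + 1
Q _    _          = + 0

neg : PS → PS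
neg f n = - f n

Fser : PS
Fser n = + (n !)

Aser : MeshSet → PS
Aser R n = + s R n 0

-- F(x,q) = Σ xⁿ Σ_{π ∈ S_n} q^{p(π)} ; coefficient of xⁿ qᵏ is s_{n,k}(p)
Fq : MeshSet → PS₂
Fq R n k = + s R n k

denomA : PS
denomA = one ⊕ (X ⊗ (Fser ⊕ neg one))

denomF : PS₂
denomF = lift one ⊕₂ ((lift one ⊕₂ (λ n k → - Q n k)) ⊗₂ lift (X ⊗ (Fser ⊕ neg one)))

Rs : Fin 8 → MeshSet
Rs f0 = (fs f0 , fs (fs f0)) ∷ (fs (fs f0) , fs (fs f0)) ∷ (f0 , fs f0) ∷ (fs f0 , fs f0) ∷ (fs (fs f0) , fs f0) ∷ (f0 , f0) ∷ []
Rs (fs f0) = (fs f0 , fs (fs f0)) ∷ (fs (fs f0) , fs (fs f0)) ∷ (f0 , fs f0) ∷ (fs f0 , fs f0) ∷ (f0 , f0) ∷ (fs f0 , f0) ∷ []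
Rs (fs (fs f0)) = (fs f0 , fs (fs f0)) ∷ (fs (fs f0) , fs (fs f0)) ∷ (fs f0 , fs f0) ∷ (fs (fs f0) , fs f0) ∷ (f0 , f0) ∷ (fs f0 , f0) ∷ []
Rs (fs (fs (fs f0))) = (fs (fs f0) , fs (fs f0)) ∷ (f0 , fs f0) ∷ (fs f0 , fs f0) ∷ (fs (fs f0) , fs f0) ∷ (f0 , f0) ∷ (fs f0 , f0) ∷ []
Rs (fs (fs (fs (fs f0)))) = (f0 , fs (fs f0)) ∷ (fs (fs f0) , fs (fs f0)) ∷ (f0 , fs f0) ∷ (fs f0 , fs f0) ∷ (fs (fs f0) , fs f0) ∷ (fs f0 , f0) ∷ []
Rs (fs (fs (fs (fs (fs f0))))) = (f0 , fs (fs f0)) ∷ (fs f0 , fs (fs f0)) ∷ (fs f0 , fs f0) ∷ (fs (fs f0) , fs f0) ∷ (f0 , f0) ∷ (fs f0 , f0) ∷ []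
Rs (fs (fs (fs (fs (fs (fs f0)))))) = (fs f0 , fs (fs f0)) ∷ (f0 , fs f0) ∷ (fs f0 , fs f0) ∷ (fs (fs f0) , fs f0) ∷ (f0 , f0) ∷ (fs (fs f0) , f0) ∷ []
Rs (fs (fs (fs (fs (fs (fs (fs f0))))))) = (fs f0 , fs (fs f0)) ∷ (fs (fs f0) , fs (fs f0)) ∷ (f0 , fs f0) ∷ (fs f0 , fs f0) ∷ (fs f0 , f0) ∷ (fs (fs f0) , f0) ∷ []

{-# OPTIONS --safe #-}

-- An occurrence of any of the eight patterns singles out an "inner" permutation ρ of [r], and contracting ρ and
-- the two points of the occurrence to one point leaves an "outer" permutation ω of [n − r − 1]; any ω and ρ
-- arise exactly once.  The occurrences of π are nested, and those of ρ are exactly the occurrences of π inside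
-- the chosen one.  So if π has more than k occurrences, exactly one of them has an inner permutation with k
-- occurrences, whence
--
--   #{π ∈ Sₙ : p(π) > k} = Σ_r (n − r − 1)! s_{r,k}     (r ≤ n − 2).
--
-- Together with |Sₙ| = n! this determines all s_{n,k}, and it is the coefficient form of both identities.
-- Inversion and reverse-complement reduce the eight patterns to Rs 3 and Rs 6, in which ρ occupies the smallest
-- values: after both points of the occurrence (Rs 3), or between them (Rs 6).

module Submission where

open import Defs
open import Data.Bool using (Bool; true; false; not; T)
open import Data.Bool.ListAction using (any)
open import Data.Bool.Properties using (T-∧)
open import Data.Empty using (⊥-elim)
open import Data.Fin using (Fin; toℕ; fromℕ<; opposite; _<_; #_) renaming (zero to f0; suc to fs)
open import Data.Fin.Properties using (toℕ-injective; toℕ<n; toℕ-fromℕ<; opposite-prop; opposite-involutive)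
import Data.Fin.Properties as Fin
open import Data.Integer using (ℤ; +_; -_) renaming (_+_ to _+ℤ_; _*_ to _*ℤ_)
import Data.Integer.Properties as ℤ
open import Data.Integer.Tactic.RingSolver using () renaming (solve-∀ to ℤ-solve)
open import Data.List using (List; []; _∷_; _++_; map; length; concatMap; filter; filterᵇ;
  cartesianProduct; cartesianProductWith; allFin; downFrom)
open import Data.List.Membership.DecPropositional using () renaming (_∈?_ to member?)
open import Data.List.Membership.Propositional using (_∈_; _∉_; find; lose)
open import Data.List.Membership.Propositional.Properties
open import Data.List.Properties using (∷-injective; ++-assoc; length-++; length-++-sucʳ; length-map; length-downFrom)
import Data.List.Properties as List
open import Data.List.Relation.Binary.Permutation.Propositional using (_↭_; prep; ↭-sym; ↭-trans; ↭-reflexive; ↭⇒↭ₛ)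
import Data.List.Relation.Binary.Permutation.Propositional.Properties as Perm
import Data.List.Relation.Binary.Permutation.Setoid.Properties as PermSetoid
open import Data.List.Relation.Unary.All as All using (All; []; _∷_)
import Data.List.Relation.Unary.All.Properties as All
open import Data.List.Relation.Unary.AllPairs using ([]; _∷_)
open import Data.List.Relation.Unary.Any using (here; there)
open import Data.List.Relation.Unary.Any.Properties using (any⁺; any⁻)
open import Data.List.Relation.Unary.Unique.Propositional using (Unique)
import Data.List.Relation.Unary.Unique.Propositional.Properties as Unique
open import Data.Nat using (ℕ; zero; suc; z≤n; s≤s; _≤_; _+_; _*_; _∸_; _!; _≡ᵇ_; _<ᵇ_)
import Data.Nat as ℕ
import Data.Nat.Properties as ℕ
open import Data.Product using (_×_; _,_; proj₁; proj₂; ∃; swap)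
open import Data.Product.Properties using (≡-dec)
open import Data.Sum using (_⊎_; inj₁; inj₂)
open import Data.Vec using (Vec; []; _∷_; toList; lookup; tabulate)
import Data.Vec as Vec
import Data.Vec.Properties as Vec
open import Function using (Equivalence; _∘_)
open import Relation.Binary using (tri<; tri≈; tri>)
open import Relation.Binary.PropositionalEquality
open import Relation.Nullary using (¬_; Dec; yes; no)
open import Relation.Nullary.Decidable using (True; toWitness; from-yes; ¬?; _→-dec_)

-- The middle row of both representative patterns is fully shaded, so the two points of an
-- occurrence have consecutive values. Counted from 0, the lower value `r` is therefore also the
-- size of ρ, and `r` alone names the occurrence. Nesting becomes the order of numbers: the
-- occurrences inside the one named `r` are those with smaller names, so ρ has k occurrences exactly
-- when `r` has rank k among the names. This is why permutations with more than k occurrences are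
-- counted: such a permutation has exactly one name of rank k, whereas an arbitrary choice of
-- occurrence would leave the decomposition ambiguous. The bound r ≤ n - 2 reflects that ω contains
-- the contracted point. Contraction is treated as a relation between permutations and triples (r,
-- ω, ρ); the count follows from its totality and injectivity in both directions.

-- Counting duplicate-free lists and cutting words

∈-drop-mid : {A : Set} (as : List A) {bs : List A} {x y : A} → y ∈ as ++ x ∷ bs → y ≢ x → y ∈ as ++ bs
∈-drop-mid as y∈ y≢x with ∈-++⁻ as y∈
... | inj₁ p = ∈-++⁺ˡ p
... | inj₂ (here p) = ⊥-elim (y≢x p)
... | inj₂ (there p) = ∈-++⁺ʳ as p

-- Pigeonhole for a relation instead of a function: the partner `y` of the head is deleted from
-- `ys`, and injectivity keeps it from being the partner of a later element. One relation can thus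
-- serve both inequalities of a bijective count.
length-≤ : {A B : Set} (_~_ : A → B → Set) {xs : List A} {ys : List B} → Unique xs →
  (∀ {x} → x ∈ xs → ∃ λ y → y ∈ ys × x ~ y) →
  (∀ {x x′ y} → x ∈ xs → x′ ∈ xs → x ~ y → x′ ~ y → x ≡ x′) →
  length xs ≤ length ys
length-≤ _~_ {[]} _ _ _ = z≤n
length-≤ _~_ {x ∷ xs} {ys} (x≢ ∷ uniq) total inj with total (here refl)
... | y , y∈ , x~y with ∈-∃++ y∈
... | as , bs , refl = subst (suc (length xs) ≤_) (sym (length-++-sucʳ as y bs))
        (s≤s (length-≤ _~_ uniq total′ (λ p q → inj (there p) (there q))))
  where
  total′ : ∀ {z} → z ∈ xs → ∃ λ w → w ∈ as ++ bs × z ~ w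
  total′ z∈ with total (there z∈)
  ... | w , w∈ , z~w = w , ∈-drop-mid as w∈ (λ { refl → All.lookup x≢ z∈ (inj (here refl) (there z∈) x~y z~w) }) , z~w

length-⊆ : {A : Set} {xs ys : List A} → Unique xs → (∀ {x} → x ∈ xs → x ∈ ys) → length xs ≤ length ys
length-⊆ u f = length-≤ _≡_ u (λ p → _ , f p , refl) (λ _ _ e e′ → trans e (sym e′))

length-≡ : {A : Set} {xs ys : List A} → Unique xs → Unique ys →
  (∀ {x} → x ∈ xs → x ∈ ys) → (∀ {x} → x ∈ ys → x ∈ xs) → length xs ≡ length ys
length-≡ u v f g = ℕ.≤-antisym
  (length-⊆ u f)
  (length-⊆ v g)

map-unique : {A B : Set} (f : A → B) {xs : List A} →
  (∀ {x y} → x ∈ xs → y ∈ xs → f x ≡ f y → x ≡ y) → Unique xs → Unique (map f xs)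
map-unique f {[]} inj [] = []
map-unique f {x ∷ xs} inj (x≢ ∷ u) =
  All.tabulate (λ {z} z∈ e → let (w , w∈ , z≡) = ∈-map⁻ f z∈ in
    All.lookup x≢ w∈ (inj (here refl) (there w∈) (trans e z≡)))
  ∷ map-unique f (λ p q → inj (there p) (there q)) u

-- `key` recovers from an element the block that it came from, so different blocks are disjoint.
concatMap-unique : {A B : Set} (f : A → List B) (key : B → A) → (∀ x {y} → y ∈ f x → key y ≡ x) →
  (∀ x → Unique (f x)) → {xs : List A} → Unique xs → Unique (concatMap f xs)
concatMap-unique f key keyed uf [] = []
concatMap-unique f key keyed uf {x ∷ xs} (x≢ ∷ u) =
  Unique.++⁺ (uf x) (concatMap-unique f key keyed uf u) disjoint
  where
  disjoint : ∀ {y} → ¬ (y ∈ f x × y ∈ concatMap f xs)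
  disjoint (p , q) with find (∈-concatMap⁻ f q)
  ... | z , z∈ , y∈ = All.lookup x≢ z∈ (trans (sym (keyed x p)) (keyed z y∈))

module _ {A : Set} where

  -- Compares two cuts of one word: a marked letter absent from `P` must sit in `Q`, so `P` is a
  -- prefix of what precedes it. `split-∉ʳ` is the mirror image. Both serve to locate one occurrence
  -- relative to the blocks of another.
  split-∉ˡ : (P : List A) {Q : List A} (α : List A) {x : A} {β : List A} →
    P ++ Q ≡ α ++ x ∷ β → x ∉ P → ∃ λ γ → α ≡ P ++ γ × Q ≡ γ ++ x ∷ β
  split-∉ˡ [] α e x∉ = α , refl , e
  split-∉ˡ (p ∷ P) [] refl x∉ = ⊥-elim (x∉ (here refl))
  split-∉ˡ (p ∷ P) (a ∷ α) e x∉ with ∷-injective e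
  ... | refl , e′ with split-∉ˡ P α e′ (λ q → x∉ (there q))
  ... | γ , refl , f = γ , refl , f

  split-∉ʳ : (P : List A) {Q : List A} (α : List A) {x : A} {β : List A} →
    P ++ Q ≡ α ++ x ∷ β → x ∉ Q → ∃ λ ε → P ≡ α ++ x ∷ ε × β ≡ ε ++ Q
  split-∉ʳ [] α refl x∉ = ⊥-elim (x∉ (∈-++⁺ʳ α (here refl)))
  split-∉ʳ (p ∷ P) [] refl x∉ = P , refl , refl
  split-∉ʳ (p ∷ P) (a ∷ α) e x∉ with ∷-injective e
  ... | refl , e′ with split-∉ʳ P α e′ x∉
  ... | ε , refl , f = ε , refl , f

  split-unique : (α : List A) {α′ : List A} {x : A} {β β′ : List A} →
    α ++ x ∷ β ≡ α′ ++ x ∷ β′ → x ∉ α → x ∉ α′ → α ≡ α′ × β ≡ β′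
  split-unique [] {[]} refl _ _ = refl , refl
  split-unique [] {a ∷ α′} refl _ q = ⊥-elim (q (here refl))
  split-unique (a ∷ α) {[]} refl q _ = ⊥-elim (q (here refl))
  split-unique (a ∷ α) {b ∷ α′} e p q with ∷-injective e
  ... | refl , e′ with split-unique α e′ (λ r → p (there r)) (λ r → q (there r))
  ... | refl , refl = refl , refl

length-cartesianProductWith : {A B C : Set} (f : A → B → C) (xs : List A) (ys : List B) →
  length (cartesianProductWith f xs ys) ≡ length xs * length ys
length-cartesianProductWith f [] ys = refl
length-cartesianProductWith f (x ∷ xs) ys = trans (length-++ (map (f x) ys))
  (cong₂ _+_ (length-map (f x) ys) (length-cartesianProductWith f xs ys))

unique-++⁻ : {A : Set} (xs : List A) {ys : List A} → Unique (xs ++ ys) → Unique xs × Unique ys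
unique-++⁻ [] u = [] , u
unique-++⁻ (x ∷ xs) (x≢ ∷ u) with unique-++⁻ xs u
... | v , w = All.++⁻ˡ xs x≢ ∷ v , w

T-not⁻ : ∀ {b} → T (not b) → ¬ T b
T-not⁻ {false} _ ()

T-not⁺ : ∀ {b} → ¬ T b → T (not b)
T-not⁺ {false} _ = _
T-not⁺ {true} f = f _

map-preimage : {A B : Set} (f : A → B) {l : List B} → (∀ {y} → y ∈ l → ∃ λ x → f x ≡ y) → ∃ λ l′ → map f l′ ≡ l
map-preimage f {[]} h = [] , refl
map-preimage f {y ∷ l} h with h (here refl) | map-preimage f (λ p → h (there p))
... | x , refl | l′ , refl = x ∷ l′ , refl

-- Permutations as lists of values

IsPerm : ℕ → List ℕ → Set
IsPerm n l = Unique l × (∀ {v} → v ∈ l → v ℕ.< n) × (∀ {v} → v ℕ.< n → v ∈ l)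

bounded-length : ∀ {n l} → Unique l → (∀ {v} → v ∈ l → v ℕ.< n) → length l ≤ n
bounded-length {n} {l} u b = subst (length l ≤_) (length-downFrom n)
  (length-⊆ u (∈-downFrom⁺ ∘ b))

isPerm-length : ∀ {n l} → IsPerm n l → length l ≡ n
isPerm-length {n} (u , b , s) =
  trans (length-≡ u (Unique.downFrom⁺ n) (∈-downFrom⁺ ∘ b) (s ∘ ∈-downFrom⁻)) (length-downFrom n)

-- A missing value could be put in front of `l`, giving n + 1 distinct numbers below n.
unique-bounded⇒isPerm : ∀ {n l} → length l ≡ n → Unique l → (∀ {v} → v ∈ l → v ℕ.< n) → IsPerm n l
unique-bounded⇒isPerm {n} {l} refl u b = u , b , surj
  where
  surj : ∀ {v} → v ℕ.< n → v ∈ l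
  surj {v} v<n with member? ℕ._≟_ v l
  ... | yes v∈ = v∈
  ... | no v∉ = ⊥-elim (ℕ.1+n≰n (bounded-length (All.tabulate (λ p e → v∉ (subst (_∈ l) (sym e) p)) ∷ u)
                   (λ { (here refl) → v<n ; (there p) → b p })))

values : ∀ {n m} → Vec (Fin n) m → List ℕ
values v = map toℕ (toList v)

values-injective : ∀ {n m} (v w : Vec (Fin n) m) → values v ≡ values w → v ≡ w
values-injective [] [] _ = refl
values-injective (x ∷ v) (y ∷ w) e with ∷-injective e
... | e₁ , e₂ = cong₂ _∷_ (toℕ-injective e₁) (values-injective v w e₂)

length-values : ∀ {n m} (v : Vec (Fin n) m) → length (values v) ≡ m
length-values [] = refl
length-values (x ∷ v) = cong suc (length-values v)

values-bounded : ∀ {n m} (v : Vec (Fin n) m) {x} → x ∈ values v → x ℕ.< n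
values-bounded v x∈ with ∈-map⁻ toℕ x∈
... | i , _ , refl = toℕ<n i

values-surjective : ∀ {n} (l : List ℕ) → (∀ {v} → v ∈ l → v ℕ.< n) → ∃ λ (v : Vec (Fin n) (length l)) → values v ≡ l
values-surjective [] b = [] , refl
values-surjective (x ∷ l) b with values-surjective l (b ∘ there)
... | v , e = fromℕ< (b (here refl)) ∷ v , cong₂ _∷_ (toℕ-fromℕ< _) e

distinct⁻ : ∀ {n} (xs : List (Fin n)) → T (distinct xs) → Unique (map toℕ xs)
distinct⁻ [] _ = []
distinct⁻ (x ∷ xs) t with Equivalence.to T-∧ t
... | t₁ , t₂ = All.tabulate fresh ∷ distinct⁻ xs t₂
  where
  fresh : ∀ {v} → v ∈ map toℕ xs → toℕ x ≢ v
  fresh v∈ e with ∈-map⁻ toℕ v∈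
  ... | y , y∈ , refl = T-not⁻ t₁ (any⁺ _ (lose y∈ (ℕ.≡⇒≡ᵇ _ _ e)))

distinct⁺ : ∀ {n} (xs : List (Fin n)) → Unique (map toℕ xs) → T (distinct xs)
distinct⁺ [] _ = _
distinct⁺ (x ∷ xs) (x≢ ∷ u) = Equivalence.from T-∧ (T-not⁺ fresh , distinct⁺ xs u)
  where
  fresh : ¬ T (any (λ y → toℕ x ≡ᵇ toℕ y) xs)
  fresh t with find (any⁻ _ xs t)
  ... | y , y∈ , e = All.lookup x≢ (∈-map⁺ toℕ y∈) (ℕ.≡ᵇ⇒≡ _ _ e)

vecs-unique : ∀ {A : Set} {xs : List A} m → Unique xs → Unique (vecs xs m)
vecs-unique zero u = [] ∷ []
vecs-unique {xs = xs} (suc m) u = concatMap-unique _ Vec.head head≡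
  (λ x → Unique.map⁺ Vec.∷-injectiveʳ (vecs-unique m u)) u
  where
  head≡ : ∀ x {v} → v ∈ map (x ∷_) (vecs xs m) → Vec.head v ≡ x
  head≡ x v∈ with ∈-map⁻ (x Vec.∷_) v∈
  ... | _ , _ , refl = refl

∈-vecs : ∀ {n m} (v : Vec (Fin n) m) → v ∈ vecs (allFin n) m
∈-vecs [] = here refl
∈-vecs (x ∷ v) = ∈-concatMap⁺ _ (lose (∈-allFin x) (∈-map⁺ (x ∷_) (∈-vecs v)))

Sn-unique : ∀ n → Unique (Sn n)
Sn-unique n = Unique.filter⁺ _ (vecs-unique n (Unique.allFin⁺ n))

∈-Sn⁻ : ∀ {n} {π : Vec (Fin n) n} → π ∈ Sn n → IsPerm n (values π)
∈-Sn⁻ {n} {π} π∈ = unique-bounded⇒isPerm (length-values π)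
  (distinct⁻ (toList π) (proj₂ (∈-filter⁻ _ {xs = vecs (allFin n) n} π∈))) (values-bounded π)

∈-Sn⁺ : ∀ {n} {π : Vec (Fin n) n} → Unique (values π) → π ∈ Sn n
∈-Sn⁺ {n} {π} u = ∈-filter⁺ _ (∈-vecs π) (distinct⁺ (toList π) u)

isPerm⇒Sn : ∀ {n l} → IsPerm n l → ∃ λ (π : Vec (Fin n) n) → π ∈ Sn n × values π ≡ l
isPerm⇒Sn {n} {l} p@(u , b , _) with length l | isPerm-length p | values-surjective l b
... | _ | refl | π , refl = π , ∈-Sn⁺ u , refl

Perms : ℕ → List (List ℕ)
Perms n = map values (Sn n)

Perms-unique : ∀ n → Unique (Perms n)
Perms-unique n = Unique.map⁺ (values-injective _ _) (Sn-unique n)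

∈-Perms⁻ : ∀ {n l} → l ∈ Perms n → IsPerm n l
∈-Perms⁻ l∈ with ∈-map⁻ values l∈
... | π , π∈ , refl = ∈-Sn⁻ π∈

∈-Perms⁺ : ∀ {n l} → IsPerm n l → l ∈ Perms n
∈-Perms⁺ p with isPerm⇒Sn p
... | π , π∈ , refl = ∈-map⁺ values π∈

-- The number of permutations is n!

-- The increasing enumeration of the naturals other than `v`, that is, `punchIn` on ℕ.
bump : ℕ → ℕ → ℕ
bump zero x = suc x
bump (suc v) zero = zero
bump (suc v) (suc x) = suc (bump v x)

bump-injective : ∀ v {x y} → bump v x ≡ bump v y → x ≡ y
bump-injective zero refl = refl
bump-injective (suc v) {zero} {zero} e = refl
bump-injective (suc v) {suc x} {suc y} e = cong suc (bump-injective v (ℕ.suc-injective e))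

bump-≢ : ∀ v x → bump v x ≢ v
bump-≢ (suc v) (suc x) e = bump-≢ v x (ℕ.suc-injective e)

bump-surjective : ∀ v {y} → y ≢ v → ∃ λ x → bump v x ≡ y
bump-surjective zero {zero} ne = ⊥-elim (ne refl)
bump-surjective zero {suc y} ne = y , refl
bump-surjective (suc v) {zero} ne = zero , refl
bump-surjective (suc v) {suc y} ne with bump-surjective v (ne ∘ cong suc)
... | x , e = suc x , cong suc e

bump-<⁺ : ∀ v {x n} → x ℕ.< n → bump v x ℕ.< suc n
bump-<⁺ zero p = s≤s p
bump-<⁺ (suc v) {zero} p = s≤s z≤n
bump-<⁺ (suc v) {suc x} (s≤s p) = s≤s (bump-<⁺ v p)

bump-<⁻ : ∀ {v x n} → v ℕ.< suc n → bump v x ℕ.< suc n → x ℕ.< n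
bump-<⁻ {zero} _ (s≤s q) = q
bump-<⁻ {suc v} {zero} {suc n} _ _ = s≤s z≤n
bump-<⁻ {suc v} {zero} {zero} (s≤s ()) _
bump-<⁻ {suc v} {suc x} {suc n} (s≤s p) (s≤s q) = s≤s (bump-<⁻ p q)

-- A permutation is its first value together with the standardisation of the rest; `bump` undoes the
-- standardisation.
length-Sn : ∀ n → length (Sn n) ≡ n !
length-Sn zero = refl
length-Sn (suc n) = begin
  length (Sn (suc n))                   ≡⟨ length-map values (Sn (suc n)) ⟨
  length (Perms (suc n))                ≡⟨ length-≡ (Perms-unique (suc n)) extensions-unique to from ⟩
  length extensions                     ≡⟨ length-cartesianProductWith extend (downFrom (suc n)) (Perms n) ⟩
  length (downFrom (suc n)) * length (Perms n)
    ≡⟨ cong₂ _*_ (length-downFrom (suc n)) (trans (length-map values (Sn n)) (length-Sn n)) ⟩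
  suc n !                               ∎
  where
  open ≡-Reasoning
  extend : ℕ → List ℕ → List ℕ
  extend v l = v ∷ map (bump v) l
  extensions : List (List ℕ)
  extensions = cartesianProductWith extend (downFrom (suc n)) (Perms n)
  extensions-unique : Unique extensions
  extensions-unique = Unique.cartesianProductWith⁺ extend
    (λ { {v} e → let e₁ , e₂ = ∷-injective e in
         e₁ , List.map-injective (bump-injective _) (trans e₂ (cong (λ z → map (bump z) _) (sym e₁))) })
    (Unique.downFrom⁺ (suc n)) (Perms-unique n)
  to : ∀ {l} → l ∈ Perms (suc n) → l ∈ extensions
  to {l} l∈ with ∈-Perms⁻ l∈
  to {[]} l∈ | _ , _ , s with s (s≤s z≤n)
  ... | ()
  to {v ∷ l} l∈ | v≢ ∷ u , b , s with map-preimage (bump v) {l} (λ p → bump-surjective v (λ { refl → All.lookup v≢ p refl }))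
  ... | l′ , refl = ∈-cartesianProductWith⁺ extend (∈-downFrom⁺ (b (here refl)))
        (∈-Perms⁺ (Unique.map⁻ u , (λ p → bump-<⁻ (b (here refl)) (b (there (∈-map⁺ (bump v) p)))) , s′))
    where
    s′ : ∀ {x} → x ℕ.< n → x ∈ l′
    s′ {x} x<n with s (bump-<⁺ v x<n)
    ... | here e = ⊥-elim (bump-≢ v x e)
    ... | there p with ∈-map⁻ (bump v) p
    ... | y , y∈ , e = subst (_∈ l′) (sym (bump-injective v e)) y∈
  from : ∀ {l} → l ∈ extensions → l ∈ Perms (suc n)
  from l∈ with ∈-cartesianProductWith⁻ extend (downFrom (suc n)) (Perms n) l∈
  ... | v , l , v∈ , l∈′ , refl with ∈-Perms⁻ l∈′
  ... | u , b , s = ∈-Perms⁺ ((All.tabulate v≢ ∷ Unique.map⁺ (bump-injective v) u) , b′ , s′)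
    where
    v≢ : ∀ {x} → x ∈ map (bump v) l → v ≢ x
    v≢ x∈ e with ∈-map⁻ (bump v) x∈
    ... | y , _ , refl = bump-≢ v y (sym e)
    b′ : ∀ {x} → x ∈ v ∷ map (bump v) l → x ℕ.< suc n
    b′ (here refl) = ∈-downFrom⁻ v∈
    b′ (there x∈) with ∈-map⁻ (bump v) x∈
    ... | y , y∈ , refl = bump-<⁺ v (b y∈)
    s′ : ∀ {x} → x ℕ.< suc n → x ∈ v ∷ map (bump v) l
    s′ {x} x<n with x ℕ.≟ v
    ... | yes refl = here refl
    ... | no x≢v with bump-surjective v x≢v
    ... | y , refl = there (∈-map⁺ (bump v) (s (bump-<⁻ (∈-downFrom⁻ v∈) x<n)))

-- Occurrences as propositions

Between : ∀ {n} → Fin 3 → Fin n → Fin n → Fin n → Set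
Between f0           i j k = k < i
Between (fs f0)      i j k = i < k × k < j
Between (fs (fs f0)) i j k = j < k

between⁺ : ∀ {n} a {i j k : Fin n} → Between a i j k →
  T (strictlyBetween (lower n (suc (toℕ i)) (suc (toℕ j)) a) (suc (toℕ k)) (upper n (suc (toℕ i)) (suc (toℕ j)) a))
between⁺ f0           p = ℕ.<⇒<ᵇ p
between⁺ (fs f0)      (p , q) = Equivalence.from T-∧ (ℕ.<⇒<ᵇ p , ℕ.<⇒<ᵇ q)
between⁺ (fs (fs f0)) {k = k} p = Equivalence.from T-∧ (ℕ.<⇒<ᵇ p , ℕ.<⇒<ᵇ (toℕ<n k))

between⁻ : ∀ {n} a {i j k : Fin n} →
  T (strictlyBetween (lower n (suc (toℕ i)) (suc (toℕ j)) a) (suc (toℕ k)) (upper n (suc (toℕ i)) (suc (toℕ j)) a)) →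
  Between a i j k
between⁻ f0           t = ℕ.<ᵇ⇒< _ _ t
between⁻ (fs f0)      t = let p , q = Equivalence.to T-∧ t in ℕ.<ᵇ⇒< _ _ p , ℕ.<ᵇ⇒< _ _ q
between⁻ (fs (fs f0)) t = ℕ.<ᵇ⇒< _ _ (proj₁ (Equivalence.to T-∧ t))

Occ : ∀ {n} → MeshSet → Vec (Fin n) n → Fin n → Fin n → Set
Occ R π i j = i < j × lookup π i < lookup π j ×
  (∀ {a b} → (a , b) ∈ R → ∀ k → Between a i j k → ¬ Between b (lookup π i) (lookup π j) (lookup π k))

isOcc⁻ : ∀ {n} R (π : Vec (Fin n) n) i j → T (isOcc R π i j) → Occ R π i j
isOcc⁻ R π i j t with Equivalence.to T-∧ t
... | p , t′ with Equivalence.to T-∧ t′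
... | q , r = ℕ.<ᵇ⇒< _ _ p , ℕ.<ᵇ⇒< _ _ q , λ {a} {b} ab∈ k x y →
  T-not⁻ (All.lookup (All.all⁺ _ R r) ab∈)
    (any⁺ _ (lose (∈-allFin k) (Equivalence.from T-∧ (between⁺ a x , between⁺ b y))))

isOcc⁺ : ∀ {n} R (π : Vec (Fin n) n) i j → Occ R π i j → T (isOcc R π i j)
isOcc⁺ {n} R π i j (p , q , r) = Equivalence.from T-∧ (ℕ.<⇒<ᵇ p , Equivalence.from T-∧ (ℕ.<⇒<ᵇ q ,
  All.all⁻ _ {R} (All.tabulate λ { {a , b} ab∈ → T-not⁺ λ t →
    let k , _ , t′ = find (any⁻ _ (allFin n) t)
        x , y = Equivalence.to T-∧ t′
    in r ab∈ k (between⁻ a x) (between⁻ b y) })))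

occurrence-list : ∀ {n} R (π : Vec (Fin n) n) → ∃ λ (os : List (Fin n × Fin n)) →
  length os ≡ occurrences R π × Unique os ×
  (∀ {i j} → (i , j) ∈ os → Occ R π i j) × (∀ {i j} → Occ R π i j → (i , j) ∈ os)
occurrence-list {n} R π = _ , refl ,
  Unique.filter⁺ _ (Unique.cartesianProduct⁺ (Unique.allFin⁺ n) (Unique.allFin⁺ n)) ,
  (λ p → isOcc⁻ R π _ _ (proj₂ (∈-filter⁻ _ {xs = cartesianProduct (allFin n) (allFin n)} p))) ,
  (λ o → ∈-filter⁺ _ (∈-cartesianProduct⁺ (∈-allFin _) (∈-allFin _)) (isOcc⁺ R π _ _ o))

occurrences-≤ : ∀ {n} {R R′} {π π′ : Vec (Fin n) n} (f : Fin n × Fin n → Fin n × Fin n) →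
  (∀ {p q} → f p ≡ f q → p ≡ q) →
  (∀ {i j} → Occ R π i j → Occ R′ π′ (proj₁ (f (i , j))) (proj₂ (f (i , j)))) →
  occurrences R π ≤ occurrences R′ π′
occurrences-≤ {R = R} {R′} {π} {π′} f inj pres with occurrence-list R π | occurrence-list R′ π′
... | os , len , u , o⁻ , _ | os′ , len′ , _ , _ , o⁺ = subst₂ ℕ._≤_ len len′
  (length-≤ (λ p q → f p ≡ q) u (λ p → _ , o⁺ (pres (o⁻ p)) , refl) (λ _ _ e e′ → inj (trans e (sym e′))))

-- Inversion and reverse-complement

lookup-ext : ∀ {A : Set} {n} {v w : Vec A n} → (∀ i → lookup v i ≡ lookup w i) → v ≡ w
lookup-ext {v = v} {w} e = trans (sym (Vec.tabulate∘lookup v)) (trans (Vec.tabulate-cong e) (Vec.tabulate∘lookup w))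

∈-values⁺ : ∀ {n m} (v : Vec (Fin n) m) i → toℕ (lookup v i) ∈ values v
∈-values⁺ (x ∷ v) f0 = here refl
∈-values⁺ (x ∷ v) (fs i) = there (∈-values⁺ v i)

∈-values⁻ : ∀ {n m} (v : Vec (Fin n) m) {x} → x ∈ values v → ∃ λ i → toℕ (lookup v i) ≡ x
∈-values⁻ (y ∷ v) (here refl) = f0 , refl
∈-values⁻ (y ∷ v) (there p) = let i , e = ∈-values⁻ v p in fs i , e

lookup-injective : ∀ {n m} {v : Vec (Fin n) m} → Unique (values v) → ∀ {i j} → lookup v i ≡ lookup v j → i ≡ j
lookup-injective {v = x ∷ v} _ {f0} {f0} e = refl
lookup-injective {v = x ∷ v} (x≢ ∷ u) {f0} {fs j} e = ⊥-elim (All.lookup x≢ (∈-values⁺ v j) (cong toℕ e))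
lookup-injective {v = x ∷ v} (x≢ ∷ u) {fs i} {f0} e = ⊥-elim (All.lookup x≢ (∈-values⁺ v i) (cong toℕ (sym e)))
lookup-injective {v = x ∷ v} (x≢ ∷ u) {fs i} {fs j} e = cong fs (lookup-injective u e)

values-unique : ∀ {n m} (v : Vec (Fin n) m) → (∀ {i j} → lookup v i ≡ lookup v j → i ≡ j) → Unique (values v)
values-unique [] inj = []
values-unique (x ∷ v) inj = All.tabulate fresh ∷ values-unique v (Fin.suc-injective ∘ inj)
  where
  fresh : ∀ {y} → y ∈ values v → toℕ x ≢ y
  fresh y∈ refl with ∈-values⁻ v y∈
  ... | i , e with inj {fs i} {f0} (toℕ-injective e)
  ... | ()

lookup-surjective : ∀ {n} {π : Vec (Fin n) n} → π ∈ Sn n → ∀ v → ∃ λ i → lookup π i ≡ v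
lookup-surjective {π = π} π∈ v with ∈-values⁻ π (proj₂ (proj₂ (∈-Sn⁻ π∈)) (toℕ<n v))
... | i , e = i , toℕ-injective e

_maps_to_ : (Fin 3 × Fin 3 → Fin 3 × Fin 3) → MeshSet → MeshSet → Set
f maps R to R′ = All (λ ab → f ab ∈ R′) R

record Inverse {n} (π π′ : Vec (Fin n) n) : Set where
  constructor inverse
  field
    left  : ∀ i → lookup π′ (lookup π i) ≡ i
    right : ∀ i → lookup π (lookup π′ i) ≡ i

inverse-sym : ∀ {n} {π π′ : Vec (Fin n) n} → Inverse π π′ → Inverse π′ π
inverse-sym (inverse l r) = inverse r l

inverse-total : ∀ {n} {π : Vec (Fin n) n} → π ∈ Sn n → ∃ λ π′ → π′ ∈ Sn n × Inverse π π′
inverse-total {n} {π} π∈ = π′ , ∈-Sn⁺ (values-unique π′ inj) , inverse left right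
  where
  π′ : Vec (Fin n) n
  π′ = tabulate (λ v → proj₁ (lookup-surjective π∈ v))
  right : ∀ i → lookup π (lookup π′ i) ≡ i
  right i = trans (cong (lookup π) (Vec.lookup∘tabulate _ i)) (proj₂ (lookup-surjective π∈ i))
  left : ∀ i → lookup π′ (lookup π i) ≡ i
  left i = lookup-injective (proj₁ (∈-Sn⁻ π∈)) (right (lookup π i))
  inj : ∀ {i j} → lookup π′ i ≡ lookup π′ j → i ≡ j
  inj {i} {j} e = trans (sym (right i)) (trans (cong (lookup π) e) (right j))

inverse-injective : ∀ {n} {π π₁ π₂ : Vec (Fin n) n} → Inverse π₁ π → Inverse π₂ π → π₁ ≡ π₂
inverse-injective {π = π} {π₁} {π₂} (inverse l₁ r₁) (inverse l₂ r₂) = lookup-ext λ i →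
  trans (sym (r₂ (lookup π₁ i))) (cong (lookup π₂) (l₁ i))

-- Inversion reflects the diagram in the diagonal and exchanges the coordinates of each cell. An
-- occurrence survives if every shaded cell of `R′` comes from a shaded cell of `R`, hence the
-- direction of the `maps` hypothesis.
inverse-occ : ∀ {n R R′} {π π′ : Vec (Fin n) n} → swap maps R′ to R → Inverse π π′ →
  ∀ {i j} → Occ R π i j → Occ R′ π′ (lookup π i) (lookup π j)
inverse-occ {π = π} {π′} m (inverse l r) {i} {j} (p , q , avoid) =
  q , subst₂ _<_ (sym (l i)) (sym (l j)) p , λ {a} {b} ab∈ k x y →
    avoid (All.lookup m ab∈) (lookup π′ k)
      (subst₂ (λ u v → Between b u v (lookup π′ k)) (l i) (l j) y)
      (subst (Between a (lookup π i) (lookup π j)) (sym (r k)) x)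

inverse-occurrences : ∀ {R R′ n} (π π′ : Vec (Fin n) n) → swap maps R′ to R → Inverse π π′ →
  occurrences R π ≤ occurrences R′ π′
inverse-occurrences {R} {R′} π π′ m inv@(inverse l r) =
  occurrences-≤ {R = R} {R′} {π} {π′} (λ { (i , j) → lookup π i , lookup π j })
    (λ e → cong₂ _,_ (injective (cong proj₁ e)) (injective (cong proj₂ e)))
    (inverse-occ {R = R} {R′} {π} {π′} m inv)
  where
  injective : ∀ {i j} → lookup π i ≡ lookup π j → i ≡ j
  injective {i} {j} e = trans (sym (l i)) (trans (cong (lookup π′) e) (l j))

record RevComp {n} (π π′ : Vec (Fin n) n) : Set where
  constructor revComp
  field
    apply : ∀ i → lookup π′ (opposite i) ≡ opposite (lookup π i)

opposite-injective : ∀ {n} {i j : Fin n} → opposite i ≡ opposite j → i ≡ j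
opposite-injective {i = i} {j} e =
  trans (sym (opposite-involutive i)) (trans (cong opposite e) (opposite-involutive j))

opposite-< : ∀ {n} {i j : Fin n} → i < j → opposite j < opposite i
opposite-< {n} {i} {j} p = subst₂ ℕ._<_ (sym (opposite-prop j)) (sym (opposite-prop i))
  (ℕ.∸-monoʳ-< (s≤s p) (toℕ<n j))

revComp-sym : ∀ {n} {π π′ : Vec (Fin n) n} → RevComp π π′ → RevComp π′ π
revComp-sym {π = π} {π′} (revComp rc) = revComp λ i → sym (trans (cong opposite
  (trans (cong (lookup π′) (sym (opposite-involutive i))) (rc (opposite i)))) (opposite-involutive _))

revComp-total : ∀ {n} {π : Vec (Fin n) n} → π ∈ Sn n → ∃ λ π′ → π′ ∈ Sn n × RevComp π π′
revComp-total {n} {π} π∈ = π′ , ∈-Sn⁺ (values-unique π′ inj) ,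
  revComp λ i → trans (lookup-π′ (opposite i)) (cong (opposite ∘ lookup π) (opposite-involutive i))
  where
  π′ : Vec (Fin n) n
  π′ = tabulate (λ i → opposite (lookup π (opposite i)))
  lookup-π′ : ∀ i → lookup π′ i ≡ opposite (lookup π (opposite i))
  lookup-π′ = Vec.lookup∘tabulate _
  inj : ∀ {i j} → lookup π′ i ≡ lookup π′ j → i ≡ j
  inj {i} {j} e = opposite-injective (lookup-injective (proj₁ (∈-Sn⁻ π∈))
    (opposite-injective (trans (sym (lookup-π′ i)) (trans e (lookup-π′ j)))))

revComp-injective : ∀ {n} {π π₁ π₂ : Vec (Fin n) n} → RevComp π₁ π → RevComp π₂ π → π₁ ≡ π₂
revComp-injective (revComp rc₁) (revComp rc₂) = lookup-ext λ i → opposite-injective (trans (sym (rc₁ i)) (rc₂ i))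

rotate : Fin 3 × Fin 3 → Fin 3 × Fin 3
rotate (a , b) = opposite a , opposite b

unopposite-< : ∀ {n} {i j : Fin n} → opposite i < opposite j → j < i
unopposite-< p = subst₂ _<_ (opposite-involutive _) (opposite-involutive _) (opposite-< p)

between-opposite : ∀ {n} a {i j k : Fin n} → Between a (opposite j) (opposite i) (opposite k) → Between (opposite a) i j k
between-opposite f0           p       = unopposite-< p
between-opposite (fs f0)      (p , q) = unopposite-< q , unopposite-< p
between-opposite (fs (fs f0)) p       = unopposite-< p

-- Reverse-complement is a half turn of the diagram, so the two points of an occurrence change
-- places.
revComp-occ : ∀ {n R R′} {π π′ : Vec (Fin n) n} → rotate maps R′ to R → RevComp π π′ →
  ∀ {i j} → Occ R π i j → Occ R′ π′ (opposite j) (opposite i)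
revComp-occ {π = π} {π′} m (revComp rc) {i} {j} (p , q , avoid) =
  opposite-< p , subst₂ _<_ (sym (rc j)) (sym (rc i)) (opposite-< q) , λ {a} {b} ab∈ k x y →
    avoid (All.lookup m ab∈) (opposite k)
      (between-opposite a (subst (Between a _ _) (sym (opposite-involutive k)) x))
      (between-opposite b (subst₂ (λ u v → Between b u v _) (rc j) (rc i)
        (subst (Between b _ _) (trans (cong (lookup π′) (sym (opposite-involutive k))) (rc (opposite k))) y)))

revComp-occurrences : ∀ {R R′ n} (π π′ : Vec (Fin n) n) → rotate maps R′ to R → RevComp π π′ →
  occurrences R π ≤ occurrences R′ π′
revComp-occurrences {R} {R′} π π′ m rc =
  occurrences-≤ {R = R} {R′} {π} {π′} (λ { (i , j) → opposite j , opposite i })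
    (λ e → cong₂ _,_ (opposite-injective (cong proj₂ e)) (opposite-injective (cong proj₁ e)))
    (revComp-occ {R = R} {R′} {π} {π′} m rc)

-- A relation fits here because an inverse exists only for vectors in `Sn`. The single inequality
-- `occ-≤` suffices as a field: `symmetric` yields the reverse one.
record Symmetry : Set₁ where
  field
    _~_ : ∀ {n} → Vec (Fin n) n → Vec (Fin n) n → Set
    total : ∀ {n} {π : Vec (Fin n) n} → π ∈ Sn n → ∃ λ π′ → π′ ∈ Sn n × π ~ π′
    symmetric : ∀ {n} {π π′ : Vec (Fin n) n} → π ~ π′ → π′ ~ π
    injective : ∀ {n} {π π₁ π₂ : Vec (Fin n) n} → π₁ ~ π → π₂ ~ π → π₁ ≡ π₂
    cell : Fin 3 × Fin 3 → Fin 3 × Fin 3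
    occ-≤ : ∀ {R R′ n} (π π′ : Vec (Fin n) n) → cell maps R′ to R → π ~ π′ →
      occurrences R π ≤ occurrences R′ π′

  occ-≡ : ∀ {R R′ n} (π π′ : Vec (Fin n) n) → cell maps R to R′ → cell maps R′ to R → π ~ π′ →
    occurrences R π ≡ occurrences R′ π′
  occ-≡ {R} {R′} π π′ m m′ r = ℕ.≤-antisym (occ-≤ {R} {R′} π π′ m′ r) (occ-≤ {R′} {R} π′ π m (symmetric r))

  s-≤ : ∀ R R′ → cell maps R to R′ → cell maps R′ to R → ∀ n k → s R n k ≤ s R′ n k
  s-≤ R R′ m m′ n k = length-≤ _~_
      {filterᵇ (λ π → occurrences R π ≡ᵇ k) (Sn n)} {filterᵇ (λ π → occurrences R′ π ≡ᵇ k) (Sn n)}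
      (Unique.filter⁺ _ (Sn-unique n)) total′ (λ _ _ → injective)
    where
    total′ : ∀ {π} → π ∈ filterᵇ (λ π → occurrences R π ≡ᵇ k) (Sn n) →
      ∃ λ π′ → π′ ∈ filterᵇ (λ π → occurrences R′ π ≡ᵇ k) (Sn n) × π ~ π′
    total′ {π} p with ∈-filter⁻ _ {xs = Sn n} p
    ... | π∈ , occ with total π∈
    ... | π′ , π′∈ , r = π′ , ∈-filter⁺ _ π′∈ (subst (λ z → T (z ≡ᵇ k)) (occ-≡ {R} {R′} π π′ m m′ r) occ) , r

inverseSymmetry : Symmetry
inverseSymmetry = record
  { _~_ = Inverse ; total = inverse-total ; symmetric = inverse-sym ; injective = inverse-injective
  ; cell = swap ; occ-≤ = inverse-occurrences }

revCompSymmetry : Symmetry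
revCompSymmetry = record
  { _~_ = RevComp ; total = revComp-total ; symmetric = revComp-sym ; injective = revComp-injective
  ; cell = rotate ; occ-≤ = revComp-occurrences }

_∈ᴿ?_ : (ab : Fin 3 × Fin 3) (R : MeshSet) → Dec (ab ∈ R)
_∈ᴿ?_ = member? (≡-dec Fin._≟_ Fin._≟_)

maps? : (f : Fin 3 × Fin 3 → Fin 3 × Fin 3) (R R′ : MeshSet) → Dec (f maps R to R′)
maps? f R R′ = All.all? (λ ab → f ab ∈ᴿ? R′) R

-- The implicit `True` arguments let type checking verify that the shaded cells correspond.
symmetric-s : (σ : Symmetry) (let open Symmetry σ) (i j : Fin 8)
  {_ : True (maps? cell (Rs i) (Rs j))} {_ : True (maps? cell (Rs j) (Rs i))} →
  ∀ n k → s (Rs i) n k ≡ s (Rs j) n k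
symmetric-s σ i j {p} {q} n k = ℕ.≤-antisym
  (Symmetry.s-≤ σ (Rs i) (Rs j) (toWitness p) (toWitness q) n k)
  (Symmetry.s-≤ σ (Rs j) (Rs i) (toWitness q) (toWitness p) n k)

-- The orbits are the patterns 0 to 3 and 4 to 7. These symmetries do not join the two orbits; their
-- common recurrence does.
Rs-by-symmetry : (P : (ℕ → ℕ → ℕ) → Set) (resp : ∀ {f g} → (∀ n k → f n k ≡ g n k) → P f → P g) →
  P (s (Rs (# 3))) → P (s (Rs (# 6))) → ∀ i → P (s (Rs i))
Rs-by-symmetry P resp p₃ p₆ = λ where
    f0                               → resp (symmetric-s revCompSymmetry (# 3) (# 0)) p₃
    (fs f0)                          → p₁
    (fs (fs f0))                     → resp (symmetric-s revCompSymmetry (# 1) (# 2)) p₁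
    (fs (fs (fs f0)))                → p₃
    (fs (fs (fs (fs f0))))           → resp (symmetric-s revCompSymmetry (# 6) (# 4)) p₆
    (fs (fs (fs (fs (fs f0)))))      → p₅
    (fs (fs (fs (fs (fs (fs f0)))))) → p₆
    (fs (fs (fs (fs (fs (fs (fs f0))))))) → resp (symmetric-s revCompSymmetry (# 5) (# 7)) p₅
  where
  p₁ : P (s (Rs (# 1)))
  p₁ = resp (symmetric-s inverseSymmetry (# 3) (# 1)) p₃
  p₅ : P (s (Rs (# 5)))
  p₅ = resp (symmetric-s inverseSymmetry (# 6) (# 5)) p₆

-- The two representative patterns

data Kind : Set where
  right middle : Kind

mesh : Kind → MeshSet
mesh right  = Rs (# 3)
mesh middle = Rs (# 6)

-- Every column of these two patterns has exactly one unshaded cell.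
row : Kind → Fin 3 → Fin 3
row right  f0           = # 2
row right  (fs f0)      = # 2
row right  (fs (fs f0)) = # 0
row middle f0           = # 2
row middle (fs f0)      = # 0
row middle (fs (fs f0)) = # 2

shaded⁺ : ∀ κ a b → b ≢ row κ a → (a , b) ∈ mesh κ
shaded⁺ right  = from-yes (Fin.all? λ a → Fin.all? λ b → ¬? (b Fin.≟ row right a) →-dec ((a , b) ∈ᴿ? mesh right))
shaded⁺ middle = from-yes (Fin.all? λ a → Fin.all? λ b → ¬? (b Fin.≟ row middle a) →-dec ((a , b) ∈ᴿ? mesh middle))

shaded⁻ : ∀ κ a b → (a , b) ∈ mesh κ → b ≢ row κ a
shaded⁻ right  = from-yes (Fin.all? λ a → Fin.all? λ b → ((a , b) ∈ᴿ? mesh right) →-dec ¬? (b Fin.≟ row right a))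
shaded⁻ middle = from-yes (Fin.all? λ a → Fin.all? λ b → ((a , b) ∈ᴿ? mesh middle) →-dec ¬? (b Fin.≟ row middle a))

between-some : ∀ {n} {i j k : Fin n} → k ≢ i → k ≢ j → ∃ λ a → Between a i j k
between-some {i = i} {j} {k} k≢i k≢j with Fin.<-cmp k i | Fin.<-cmp k j
... | tri< p _ _ | _          = # 0 , p
... | tri≈ _ e _ | _          = ⊥-elim (k≢i e)
... | tri> _ _ p | tri< q _ _ = # 1 , p , q
... | tri> _ _ p | tri≈ _ e _ = ⊥-elim (k≢j e)
... | tri> _ _ p | tri> _ _ q = # 2 , q

between-unique : ∀ {n} a b {i j k : Fin n} → i < j → Between a i j k → Between b i j k → a ≡ b
between-unique f0           f0           i<j p q = refl
between-unique f0           (fs f0)      i<j p (q , _) = ⊥-elim (Fin.<-asym p q)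
between-unique f0           (fs (fs f0)) i<j p q = ⊥-elim (Fin.<-asym (Fin.<-trans p i<j) q)
between-unique (fs f0)      f0           i<j (p , _) q = ⊥-elim (Fin.<-asym p q)
between-unique (fs f0)      (fs f0)      i<j p q = refl
between-unique (fs f0)      (fs (fs f0)) i<j (_ , p) q = ⊥-elim (Fin.<-asym p q)
between-unique (fs (fs f0)) f0           i<j p q = ⊥-elim (Fin.<-asym (Fin.<-trans q i<j) p)
between-unique (fs (fs f0)) (fs f0)      i<j p (_ , q) = ⊥-elim (Fin.<-asym p q)
between-unique (fs (fs f0)) (fs (fs f0)) i<j p q = refl

between-≢ : ∀ {n} a {i j k : Fin n} → i < j → Between a i j k → k ≢ i × k ≢ j
between-≢ f0           i<j p       = (λ { refl → Fin.<-irrefl refl p }) , λ { refl → Fin.<-asym p i<j }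
between-≢ (fs f0)      i<j (p , q) = (λ { refl → Fin.<-irrefl refl p }) , λ { refl → Fin.<-irrefl refl q }
between-≢ (fs (fs f0)) i<j p       = (λ { refl → Fin.<-asym p i<j }) , λ { refl → Fin.<-irrefl refl p }

-- The positive form of the mesh condition: instead of avoiding shaded cells, each further point
-- lies in the one open cell of its column.
Aligned : ∀ {n} → Kind → Vec (Fin n) n → Fin n → Fin n → Set
Aligned κ π i j = i < j × lookup π i < lookup π j ×
  (∀ a k → Between a i j k → Between (row κ a) (lookup π i) (lookup π j) (lookup π k))

-- Injectivity keeps every further point off the two horizontal mesh lines, so it lies in some cell
-- of its column, and only the open one is left.
aligned⁺ : ∀ {n κ} {π : Vec (Fin n) n} → (∀ {i j} → lookup π i ≡ lookup π j → i ≡ j) →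
  ∀ {i j} → Occ (mesh κ) π i j → Aligned κ π i j
aligned⁺ {κ = κ} {π} inj {i} {j} (i<j , q , avoid) = i<j , q , align
  where
  align : ∀ a k → Between a i j k → Between (row κ a) (lookup π i) (lookup π j) (lookup π k)
  align a k x with between-≢ a i<j x
  ... | k≢i , k≢j with between-some {i = lookup π i} {lookup π j} {lookup π k} (k≢i ∘ inj) (k≢j ∘ inj)
  ... | b , y with b Fin.≟ row κ a
  ... | yes refl = y
  ... | no b≢ = ⊥-elim (avoid (shaded⁺ κ a b b≢) k x y)

aligned⁻ : ∀ {n κ} {π : Vec (Fin n) n} {i j} → Aligned κ π i j → Occ (mesh κ) π i j
aligned⁻ {κ = κ} (p , q , align) = p , q , λ {a} {b} ab∈ k x y →
  shaded⁻ κ a b ab∈ (between-unique b (row κ a) q y (align a k x))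

-- No open cell lies in the middle row. Hence the position `k` that carries the value just above the
-- lower point can only be `j`.
aligned-consecutive : ∀ {n κ} {π : Vec (Fin n) n} → π ∈ Sn n → ∀ {i j} → Aligned κ π i j →
  toℕ (lookup π j) ≡ suc (toℕ (lookup π i))
aligned-consecutive {n} {κ} {π} π∈ {i} {j} (i<j , q , align)
  with lookup-surjective π∈ (fromℕ< (ℕ.≤-<-trans q (toℕ<n (lookup π j))))
... | k , e = hit (k Fin.≟ i) (k Fin.≟ j)
  where
  πk≡ : toℕ (lookup π k) ≡ suc (toℕ (lookup π i))
  πk≡ = trans (cong toℕ e) (toℕ-fromℕ< _)
  row-outside : ∀ κ a → Between (row κ a) (lookup π i) (lookup π j) (lookup π k) →
    lookup π k < lookup π i ⊎ lookup π j < lookup π k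
  row-outside right  f0           = inj₂
  row-outside right  (fs f0)      = inj₂
  row-outside right  (fs (fs f0)) = inj₁
  row-outside middle f0           = inj₂
  row-outside middle (fs f0)      = inj₁
  row-outside middle (fs (fs f0)) = inj₂
  hit : Dec (k ≡ i) → Dec (k ≡ j) → toℕ (lookup π j) ≡ suc (toℕ (lookup π i))
  hit (yes refl) _ = ⊥-elim (ℕ.1+n≢n (sym πk≡))
  hit (no _) (yes refl) = πk≡
  hit (no k≢i) (no k≢j) with between-some k≢i k≢j
  ... | a , x with row-outside κ a (align a k x)
  ... | inj₁ y = ⊥-elim (ℕ.<-asym y (ℕ.≤-reflexive (sym πk≡)))
  ... | inj₂ y = ⊥-elim (ℕ.<⇒≱ y (subst (ℕ._≤ _) (sym πk≡) q))

-- Occurrences as factorisations of the word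

pick : List ℕ → List ℕ → List ℕ → Fin 3 → List ℕ
pick α M E f0           = α
pick α M E (fs f0)      = M
pick α M E (fs (fs f0)) = E

cut : ∀ {n m} (v : Vec (Fin n) m) j → ∃ λ M → ∃ λ E → values v ≡ M ++ toℕ (lookup v j) ∷ E ×
  (∀ {x} → x ∈ M → ∃ λ k → k < j × toℕ (lookup v k) ≡ x) ×
  (∀ {x} → x ∈ E → ∃ λ k → j < k × toℕ (lookup v k) ≡ x)
cut (y ∷ v) f0 = [] , values v , refl , (λ ()) , λ p → let k , e = ∈-values⁻ v p in fs k , s≤s z≤n , e
cut (y ∷ v) (fs j) with cut v j
... | M , E , e , before , after = toℕ y ∷ M , E , cong (toℕ y ∷_) e , before′ ,
  λ p → let k , l , e = after p in fs k , s≤s l , e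
  where
  before′ : ∀ {x} → x ∈ toℕ y ∷ M → ∃ λ k → k < fs j × toℕ (lookup (y ∷ v) k) ≡ x
  before′ (here refl) = f0 , s≤s z≤n , refl
  before′ (there p) = let k , l , e = before p in fs k , s≤s l , e

between-suc : ∀ {n} a {i j k : Fin n} → Between a i j k → Between a (fs i) (fs j) (fs k)
between-suc f0           p       = s≤s p
between-suc (fs f0)      (p , q) = s≤s p , s≤s q
between-suc (fs (fs f0)) p       = s≤s p

between-pred : ∀ {n} a {i j k : Fin n} → Between a (fs i) (fs j) (fs k) → Between a i j k
between-pred f0           (s≤s p)       = p
between-pred (fs f0)      (s≤s p , s≤s q) = p , q
between-pred (fs (fs f0)) (s≤s p)       = p

-- Trades positions for factors of the word, with one factor per column of the mesh; `uncut₂` goes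
-- back.
cut₂ : ∀ {n m} (v : Vec (Fin n) m) {i j} → i < j → ∃ λ α → ∃ λ M → ∃ λ E →
  values v ≡ α ++ toℕ (lookup v i) ∷ M ++ toℕ (lookup v j) ∷ E ×
  (∀ a {x} → x ∈ pick α M E a → ∃ λ k → Between a i j k × toℕ (lookup v k) ≡ x)
cut₂ (y ∷ v) {f0} {fs j} _ with cut v j
... | M , E , e , before , after = [] , M , E , cong (toℕ y ∷_) e , parts
  where
  parts : ∀ a {x} → x ∈ pick [] M E a → ∃ λ k → Between a f0 (fs j) k × toℕ (lookup (y ∷ v) k) ≡ x
  parts (fs f0)      p = let k , l , e = before p in fs k , (s≤s z≤n , s≤s l) , e
  parts (fs (fs f0)) p = let k , l , e = after p in fs k , s≤s l , e
cut₂ (y ∷ v) {fs i} {fs j} (s≤s i<j) with cut₂ v i<j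
... | α , M , E , e , parts = toℕ y ∷ α , M , E , cong (toℕ y ∷_) e , parts′
  where
  shift : ∀ a {x} → (∃ λ k → Between a i j k × toℕ (lookup v k) ≡ x) →
    ∃ λ k → Between a (fs i) (fs j) k × toℕ (lookup (y ∷ v) k) ≡ x
  shift a (k , b , e) = fs k , between-suc a {i} {j} {k} b , e
  parts′ : ∀ a {x} → x ∈ pick (toℕ y ∷ α) M E a → ∃ λ k → Between a (fs i) (fs j) k × toℕ (lookup (y ∷ v) k) ≡ x
  parts′ f0           (here refl) = f0 , s≤s z≤n , refl
  parts′ f0           (there p)   = shift f0 (parts f0 p)
  parts′ (fs f0)      p           = shift (fs f0) (parts (fs f0) p)
  parts′ (fs (fs f0)) p           = shift (fs (fs f0)) (parts (fs (fs f0)) p)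

uncut : ∀ {n m} (v : Vec (Fin n) m) M {y E} → values v ≡ M ++ y ∷ E →
  ∃ λ j → toℕ (lookup v j) ≡ y × (∀ k → k < j → toℕ (lookup v k) ∈ M) × (∀ k → j < k → toℕ (lookup v k) ∈ E)
uncut [] [] ()
uncut [] (_ ∷ _) ()
uncut (x ∷ v) [] refl = f0 , refl , (λ _ ()) , λ { (fs k) _ → ∈-values⁺ v k }
uncut (x ∷ v) (_ ∷ M) e with ∷-injective e
... | refl , e′ with uncut v M e′
... | j , eq , before , after = fs j , eq , (λ { f0 _ → here refl ; (fs k) (s≤s p) → there (before k p) }) ,
  λ { (fs k) (s≤s p) → after k p }

uncut₂ : ∀ {n m} (v : Vec (Fin n) m) α M {x y E} → values v ≡ α ++ x ∷ M ++ y ∷ E → ∃ λ i → ∃ λ j →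
  i < j × toℕ (lookup v i) ≡ x × toℕ (lookup v j) ≡ y ×
  (∀ a k → Between a i j k → toℕ (lookup v k) ∈ pick α M E a)
uncut₂ [] [] _ ()
uncut₂ [] (_ ∷ _) _ ()
uncut₂ (z ∷ v) [] M {E = E} e with ∷-injective e
... | refl , e′ with uncut v M e′
... | j , eq , before , after = f0 , fs j , s≤s z≤n , refl , eq , parts
  where
  parts : ∀ a k → Between a f0 (fs j) k → toℕ (lookup (z ∷ v) k) ∈ pick [] M E a
  parts (fs f0)      (fs k) (_ , s≤s p) = before k p
  parts (fs (fs f0)) (fs k) (s≤s p)     = after k p
uncut₂ (z ∷ v) (_ ∷ α) M {E = E} e with ∷-injective e
... | refl , e′ with uncut₂ v α M e′
... | i , j , i<j , eq , eq′ , parts = fs i , fs j , s≤s i<j , eq , eq′ , parts′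
  where
  parts′ : ∀ a k → Between a (fs i) (fs j) k → toℕ (lookup (z ∷ v) k) ∈ pick (toℕ z ∷ α) M E a
  parts′ f0           f0     p = here refl
  parts′ (fs f0)      f0     (() , _)
  parts′ (fs (fs f0)) f0     ()
  parts′ f0           (fs k) p = there (parts f0 k (between-pred f0 {i} {j} {k} p))
  parts′ (fs f0)      (fs k) p = parts (fs f0) k (between-pred (fs f0) {i} {j} {k} p)
  parts′ (fs (fs f0)) (fs k) p = parts (fs (fs f0)) k (between-pred (fs (fs f0)) {i} {j} {k} p)

-- The occurrence consists of the values r and suc r, ρ is the inner permutation and α, β is everything else.
place : Kind → ℕ → List ℕ → List ℕ → List ℕ → List ℕ
place right  r α β ρ = α ++ r ∷ β ++ suc r ∷ ρ
place middle r α β ρ = α ++ r ∷ ρ ++ suc r ∷ β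

record Fits (r : ℕ) (α β ρ : List ℕ) : Set where
  constructor fits
  field
    high-α : ∀ {v} → v ∈ α → suc r ℕ.< v
    high-β : ∀ {v} → v ∈ β → suc r ℕ.< v
    low-ρ  : ∀ {v} → v ∈ ρ → v ℕ.< r

-- An occurrence read off the bare word and named by its lower value. In this form it can be carried
-- between a permutation and its inner permutation, which are vectors of different types.
Key : Kind → ℕ → List ℕ → Set
Key κ r π = ∃ λ α → ∃ λ β → ∃ λ ρ → π ≡ place κ r α β ρ × Fits r α β ρ

-- `Between` on the value axis for the consecutive values `r` and `suc r`; its middle case is empty.
Row : Fin 3 → ℕ → ℕ → Set
Row f0           r v = v ℕ.< r
Row (fs f0)      r v = r ℕ.< v × v ℕ.< suc r
Row (fs (fs f0)) r v = suc r ℕ.< v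

row⁺ : ∀ {n} b {i j k : Fin n} → toℕ j ≡ suc (toℕ i) → Between b i j k → Row b (toℕ i) (toℕ k)
row⁺ f0           e p       = p
row⁺ (fs f0)      e (p , q) = p , subst (_ ℕ.<_) e q
row⁺ (fs (fs f0)) e p       = subst (ℕ._< _) e p

row⁻ : ∀ {n} b {i j k : Fin n} → toℕ j ≡ suc (toℕ i) → Row b (toℕ i) (toℕ k) → Between b i j k
row⁻ f0           e p       = p
row⁻ (fs f0)      e (p , q) = p , subst (_ ℕ.<_) (sym e) q
row⁻ (fs (fs f0)) e p       = subst (ℕ._< _) (sym e) p

key⁺ : ∀ κ {r π} α M E → π ≡ α ++ r ∷ M ++ suc r ∷ E → (∀ a {v} → v ∈ pick α M E a → Row (row κ a) r v) → Key κ r π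
key⁺ right  α M E e rows = α , M , E , e , fits (rows (# 0)) (rows (# 1)) (rows (# 2))
key⁺ middle α M E e rows = α , E , M , e , fits (rows (# 0)) (rows (# 2)) (rows (# 1))

key⁻ : ∀ κ {r π} → Key κ r π → ∃ λ α → ∃ λ M → ∃ λ E →
  π ≡ α ++ r ∷ M ++ suc r ∷ E × (∀ a {v} → v ∈ pick α M E a → Row (row κ a) r v)
key⁻ right  (α , β , ρ , e , fits h h′ l) = α , β , ρ , e , λ { f0 → h ; (fs f0) → h′ ; (fs (fs f0)) → l }
key⁻ middle (α , β , ρ , e , fits h h′ l) = α , ρ , β , e , λ { f0 → h ; (fs f0) → l ; (fs (fs f0)) → h′ }

occ⇒key : ∀ {n κ} {π : Vec (Fin n) n} → π ∈ Sn n → ∀ {i j} → Occ (mesh κ) π i j → Key κ (toℕ (lookup π i)) (values π)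
occ⇒key {n} {κ} {π} π∈ {i} {j} occ = go (cut₂ π (proj₁ al))
  where
  al : Aligned κ π i j
  al = aligned⁺ {κ = κ} {π} (lookup-injective (proj₁ (∈-Sn⁻ π∈))) occ
  consecutive : toℕ (lookup π j) ≡ suc (toℕ (lookup π i))
  consecutive = aligned-consecutive {κ = κ} {π} π∈ al
  go : _ → Key κ (toℕ (lookup π i)) (values π)
  go (α , M , E , e , parts) = key⁺ κ α M E
    (subst (λ z → values π ≡ α ++ toℕ (lookup π i) ∷ M ++ z ∷ E) consecutive e) λ a p →
      let k , b , eq = parts a p in
      subst (Row (row κ a) _) eq (row⁺ (row κ a) {lookup π i} {lookup π j} consecutive (proj₂ (proj₂ al) a k b))

key⇒occ : ∀ {n κ} {π : Vec (Fin n) n} {r} → Key κ r (values π) → ∃ λ i → ∃ λ j → Occ (mesh κ) π i j × toℕ (lookup π i) ≡ r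
key⇒occ {n} {κ} {π} {r} key with key⁻ κ key
... | α , M , E , e , rows with uncut₂ π α M e
... | i , j , i<j , refl , eq , parts = i , j ,
  aligned⁻ {κ = κ} {π} (i<j , subst (toℕ (lookup π i) ℕ.<_) (sym eq) ℕ.≤-refl ,
    λ a k b → row⁻ (row κ a) {lookup π i} {lookup π j} eq (rows a (parts a k b))) , refl

occ-determined : ∀ {n κ} {π : Vec (Fin n) n} → π ∈ Sn n → ∀ {i j i′ j′} → Occ (mesh κ) π i j → Occ (mesh κ) π i′ j′ →
  lookup π i ≡ lookup π i′ → (i , j) ≡ (i′ , j′)
occ-determined {n} {κ} {π} π∈ o o′ e = cong₂ _,_ (inj e)
    (inj (toℕ-injective (trans (consecutive o) (trans (cong (suc ∘ toℕ) e) (sym (consecutive o′))))))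
  where
  inj : ∀ {i j} → lookup π i ≡ lookup π j → i ≡ j
  inj = lookup-injective (proj₁ (∈-Sn⁻ π∈))
  consecutive : ∀ {i j} → Occ (mesh κ) π i j → toℕ (lookup π j) ≡ suc (toℕ (lookup π i))
  consecutive o = aligned-consecutive {κ = κ} {π} π∈ (aligned⁺ {κ = κ} {π} inj o)

-- An occurrence is determined by its lower value, so occurrences can be counted as numbers, and as
-- numbers they can be ranked.
record KeyList {n} (κ : Kind) (π : Vec (Fin n) n) : Set where
  constructor keyList
  field
    keys        : List ℕ
    keys-length : length keys ≡ occurrences (mesh κ) π
    keys-unique : Unique keys
    keys⁻       : ∀ {r} → r ∈ keys → Key κ r (values π)
    keys⁺       : ∀ {r} → Key κ r (values π) → r ∈ keys

keysOf : ∀ {n} κ {π : Vec (Fin n) n} → π ∈ Sn n → KeyList κ π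
keysOf {n} κ {π} π∈ with occurrence-list (mesh κ) π
... | os , len , u , o⁻ , o⁺ = keyList (map bottom os) (trans (length-map bottom os) len)
    (map-unique bottom (λ p q e → occ-determined {κ = κ} π∈ (o⁻ p) (o⁻ q) (toℕ-injective e)) u) to from
  where
  bottom : Fin n × Fin n → ℕ
  bottom (i , j) = toℕ (lookup π i)
  to : ∀ {r} → r ∈ map bottom os → Key κ r (values π)
  to r∈ with ∈-map⁻ bottom r∈
  ... | (i , j) , p , refl = occ⇒key {κ = κ} π∈ (o⁻ p)
  from : ∀ {r} → Key κ r (values π) → r ∈ map bottom os
  from key with key⇒occ {κ = κ} {π} key
  ... | i , j , o , refl = ∈-map⁺ bottom (o⁺ o)

-- Nesting of occurrences

fits-∉α : ∀ {r α β ρ} → Fits r α β ρ → r ∉ α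
fits-∉α (fits h _ _) p = ℕ.1+n≰n (ℕ.≤-trans (ℕ.n≤1+n _) (h p))

fits-∉β : ∀ {r α β ρ} → Fits r α β ρ → suc r ∉ β
fits-∉β (fits _ h _) p = ℕ.<-irrefl refl (h p)

fits-∉ρ : ∀ {r α β ρ} → Fits r α β ρ → suc r ∉ ρ
fits-∉ρ (fits _ _ l) p = ℕ.1+n≰n (ℕ.≤-trans (ℕ.n≤1+n _) (l p))

-- Both cuts are forced: `r` is absent from the block before it, and `suc r` is absent from the
-- block between the two points.
place-injective : ∀ κ {r α β ρ α′ β′ ρ′} → place κ r α β ρ ≡ place κ r α′ β′ ρ′ →
  Fits r α β ρ → Fits r α′ β′ ρ′ → α ≡ α′ × β ≡ β′ × ρ ≡ ρ′
place-injective right {α = α} {β} e f f′ with split-unique α e (fits-∉α f) (fits-∉α f′)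
... | refl , e′ with split-unique β e′ (fits-∉β f) (fits-∉β f′)
... | refl , refl = refl , refl , refl
place-injective middle {α = α} {ρ = ρ} e f f′ with split-unique α e (fits-∉α f) (fits-∉α f′)
... | refl , e′ with split-unique ρ e′ (fits-∉ρ f) (fits-∉ρ f′)
... | refl , refl = refl , refl , refl

place-right-++ : ∀ r α β ρ → (α ++ r ∷ β ++ suc r ∷ []) ++ ρ ≡ α ++ r ∷ β ++ suc r ∷ ρ
place-right-++ r α β ρ = trans (++-assoc α _ ρ) (cong (λ z → α ++ r ∷ z) (++-assoc β _ ρ))

outer-≥ : ∀ {r α β ρ} → Fits r α β ρ → ∀ {v} → v ∈ α ++ r ∷ β ++ suc r ∷ [] → r ≤ v
outer-≥ {r} {α} {β} (fits h h′ _) v∈ with ∈-++⁻ α v∈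
... | inj₁ p = ℕ.<⇒≤ (ℕ.<⇒≤ (h p))
... | inj₂ (here refl) = ℕ.≤-refl
... | inj₂ (there q) with ∈-++⁻ β q
... | inj₁ p = ℕ.<⇒≤ (ℕ.<⇒≤ (h′ p))
... | inj₂ (here refl) = ℕ.n≤1+n _

left-≥ : ∀ {r α β ρ} → Fits r α β ρ → ∀ {v} → v ∈ α ++ r ∷ [] → r ≤ v
left-≥ {r} {α} (fits h _ _) v∈ with ∈-++⁻ α v∈
... | inj₁ p = ℕ.<⇒≤ (ℕ.<⇒≤ (h p))
... | inj₂ (here refl) = ℕ.≤-refl

end-> : ∀ {r α β ρ} → Fits r α β ρ → ∀ {v} → v ∈ suc r ∷ β → r ℕ.< v
end-> _ (here refl) = ℕ.≤-refl
end-> (fits _ h _) (there p) = ℕ.<⇒≤ (h p)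

-- All letters outside `ρ` are at least `r`, so the smaller letter `r′` lies in `ρ`. For `right`,
-- `ρ` is a suffix and contains all that follows.
key-restrict : ∀ κ {r r′ α β ρ} → Fits r α β ρ → r′ ℕ.< r → Key κ r′ (place κ r α β ρ) → Key κ r′ ρ
key-restrict right {r} {r′} {α} {β} {ρ} f r′<r (α′ , β′ , ρ′ , e , fits h h′ l)
  with split-∉ˡ (α ++ r ∷ β ++ suc r ∷ []) α′ (trans (place-right-++ r α β ρ) e) (λ p → ℕ.<⇒≱ r′<r (outer-≥ f p))
... | γ , refl , eq = γ , β′ , ρ′ , eq , fits (h ∘ ∈-++⁺ʳ _) h′ l
key-restrict middle {r} {r′} {α} {β} {ρ} f r′<r (α′ , β′ , ρ′ , e , fits h h′ l)
  with split-∉ˡ (α ++ r ∷ []) α′ (trans (++-assoc α _ _) e) (λ p → ℕ.<⇒≱ r′<r (left-≥ f p))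
... | γ , refl , eq with split-∉ʳ ρ γ eq (λ p → ℕ.<-asym r′<r (end-> f p))
-- For `middle` the upper point must be located too: the letters from `suc r` on exceed `r`, whereas
-- `suc r′` is at most `r`.
... | ε , refl , eq′ with split-∉ʳ ε ρ′ (sym eq′) (λ p → ℕ.<⇒≱ r′<r (ℕ.s≤s⁻¹ (end-> f p)))
... | ε′ , refl , refl = γ , ε′ , ρ′ , refl , fits (h ∘ ∈-++⁺ʳ _) (h′ ∘ ∈-++⁺ˡ) l

key∈ : ∀ κ {r π} → Key κ r π → r ∈ π × suc r ∈ π
key∈ κ key with key⁻ κ key
... | α , M , E , refl , _ = ∈-++⁺ʳ α (here refl) , ∈-++⁺ʳ α (there (∈-++⁺ʳ M (here refl)))

-- Since `suc r′` is a letter of `ρ`, it is below `r`; every letter added around `ρ` is therefore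
-- high for the key `r′` and joins its outer blocks.
key-extend : ∀ κ {r r′ α β ρ} → Fits r α β ρ → Key κ r′ ρ → r′ ℕ.< r × Key κ r′ (place κ r α β ρ)
key-extend κ {r} {r′} {α} {β} {ρ} f key = low (proj₁ (key∈ κ key)) , extend κ f key
  where
  low : ∀ {v} → v ∈ ρ → v ℕ.< r
  low = Fits.low-ρ f
  suc< : suc r′ ℕ.< r
  suc< = low (proj₂ (key∈ κ key))
  join : ∀ {P Q : List ℕ} → (∀ {v} → v ∈ P → r ≤ v) → (∀ {v} → v ∈ Q → suc r′ ℕ.< v) → ∀ {v} → v ∈ P ++ Q → suc r′ ℕ.< v
  join {P} p q v∈ with ∈-++⁻ P v∈
  ... | inj₁ x = ℕ.<-≤-trans suc< (p x)
  ... | inj₂ x = q x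
  extend : ∀ κ → Fits r α β ρ → Key κ r′ ρ → Key κ r′ (place κ r α β ρ)
  extend right f (α′ , β′ , ρ′ , refl , fits h h′ l) =
    (α ++ r ∷ β ++ suc r ∷ []) ++ α′ , β′ , ρ′ ,
    trans (sym (place-right-++ r α β _)) (sym (++-assoc (α ++ r ∷ β ++ suc r ∷ []) α′ _)) ,
    fits (join (outer-≥ f) h) h′ l
  extend middle f (α′ , β′ , ρ′ , refl , fits h h′ l) =
    (α ++ r ∷ []) ++ α′ , β′ ++ suc r ∷ β , ρ′ , eq ,
    fits (join (left-≥ f) h) high l
    where
    high : ∀ {v} → v ∈ β′ ++ suc r ∷ β → suc r′ ℕ.< v
    high v∈ with ∈-++⁻ β′ v∈
    ... | inj₁ x = h′ x
    ... | inj₂ x = ℕ.<-trans suc< (end-> f x)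
    eq : α ++ r ∷ (α′ ++ r′ ∷ ρ′ ++ suc r′ ∷ β′) ++ suc r ∷ β ≡ ((α ++ r ∷ []) ++ α′) ++ r′ ∷ ρ′ ++ suc r′ ∷ β′ ++ suc r ∷ β
    eq = sym (trans (++-assoc (α ++ r ∷ []) α′ _) (trans (++-assoc α (r ∷ []) _) (cong (λ z → α ++ r ∷ z)
      (sym (trans (++-assoc α′ _ _) (cong (λ z → α′ ++ r′ ∷ z) (++-assoc ρ′ _ _)))))))

-- Ranks of keys

below : ℕ → List ℕ → List ℕ
below r = filter (ℕ._<? r)

rank : List ℕ → ℕ → ℕ
rank ks r = length (below r ks)

∈-below⁻ : ∀ {r ks v} → v ∈ below r ks → v ∈ ks × v ℕ.< r
∈-below⁻ {r} {ks} = ∈-filter⁻ (ℕ._<? r) {xs = ks}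

cons-below-unique : ∀ {ks r} → Unique ks → Unique (r ∷ below r ks)
cons-below-unique {ks} {r} u = All.tabulate (λ p e → ℕ.<-irrefl (sym e) (proj₂ (∈-below⁻ {r} {ks} p)))
  ∷ Unique.filter⁺ (ℕ._<? r) u

rank-mono : ∀ {ks r r′} → Unique ks → r ∈ ks → r ℕ.< r′ → rank ks r ℕ.< rank ks r′
rank-mono {ks} {r} {r′} u r∈ r<r′ = length-⊆ (cons-below-unique u) sub
  where
  sub : ∀ {v} → v ∈ r ∷ below r ks → v ∈ below r′ ks
  sub (here refl) = ∈-filter⁺ (ℕ._<? r′) r∈ r<r′
  sub (there p) = let q , v<r = ∈-below⁻ {r} {ks} p in ∈-filter⁺ (ℕ._<? r′) q (ℕ.<-trans v<r r<r′)

rank-< : ∀ {ks r} → Unique ks → r ∈ ks → rank ks r ℕ.< length ks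
rank-< {ks} {r} u r∈ = length-⊆ (cons-below-unique u) sub
  where
  sub : ∀ {v} → v ∈ r ∷ below r ks → v ∈ ks
  sub (here refl) = r∈
  sub (there p) = proj₁ (∈-below⁻ {r} {ks} p)

rank-injective : ∀ {ks r r′} → Unique ks → r ∈ ks → r′ ∈ ks → rank ks r ≡ rank ks r′ → r ≡ r′
rank-injective {ks} {r} {r′} u r∈ r′∈ e with ℕ.<-cmp r r′
... | tri< p _ _ = ⊥-elim (ℕ.<-irrefl e (rank-mono u r∈ p))
... | tri≈ _ q _ = q
... | tri> _ _ p = ⊥-elim (ℕ.<-irrefl (sym e) (rank-mono u r′∈ p))

-- The ranks of the keys are distinct and below their number, so by pigeonhole they take every
-- value.
rank-surjective : ∀ {ks k} → Unique ks → k ℕ.< length ks → ∃ λ r → r ∈ ks × rank ks r ≡ k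
rank-surjective {ks} {k} u k< with ∈-map⁻ (rank ks) (proj₂ (proj₂ ranks) k<)
  where
  bounded : ∀ {v} → v ∈ map (rank ks) ks → v ℕ.< length ks
  bounded v∈ with ∈-map⁻ (rank ks) v∈
  ... | r , r∈ , refl = rank-< u r∈
  ranks : IsPerm (length ks) (map (rank ks) ks)
  ranks = unique-bounded⇒isPerm (length-map (rank ks) ks) (map-unique (rank ks) (rank-injective u) u) bounded
... | r , r∈ , e = r , r∈ , sym e

-- Nesting turned into arithmetic: by `key-restrict` and `key-extend`, the keys below `r` are
-- exactly the keys of `ρ`.
rank≡occurrences : ∀ κ {n m r α β} {π : Vec (Fin n) n} {ρ : Vec (Fin m) m} (K : KeyList κ π) → ρ ∈ Sn m →
  values π ≡ place κ r α β (values ρ) → Fits r α β (values ρ) →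
  rank (KeyList.keys K) r ≡ occurrences (mesh κ) ρ
rank≡occurrences κ {r = r} {π = π} {ρ} (keyList ks _ u k⁻ k⁺) ρ∈ e f with keysOf κ ρ∈
... | keyList ks′ len u′ k′⁻ k′⁺ = trans (length-≡ (Unique.filter⁺ (ℕ._<? r) u) u′ to from) len
  where
  to : ∀ {r′} → r′ ∈ below r ks → r′ ∈ ks′
  to p = let q , r′<r = ∈-below⁻ {r} {ks} p in k′⁺ (key-restrict κ f r′<r (subst (Key κ _) e (k⁻ q)))
  from : ∀ {r′} → r′ ∈ ks′ → r′ ∈ below r ks
  from p = let r′<r , key = key-extend κ f (k′⁻ p) in ∈-filter⁺ (ℕ._<? r) (k⁺ (subst (Key κ _) (sym e) key)) r′<r

-- Contraction and its inverse

-- Being a permutation ignores order, so both kinds reduce to one arrangement in which inner and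
-- outer letters are separated.
place-↭ : ∀ κ r α β ρ → place κ r α β ρ ↭ suc r ∷ ρ ++ (α ++ r ∷ β)
place-↭ right r α β ρ = ↭-trans (↭-reflexive (sym (++-assoc α (r ∷ β) (suc r ∷ ρ)))) (Perm.++-comm (α ++ r ∷ β) (suc r ∷ ρ))
place-↭ middle r α β ρ = ↭-trans (Perm.++⁺ˡ α (prep r middle-to-end)) (place-↭ right r α β ρ)
  where
  middle-to-end : ρ ++ suc r ∷ β ↭ β ++ suc r ∷ ρ
  middle-to-end = ↭-trans (Perm.shift (suc r) ρ β)
    (↭-trans (prep (suc r) (Perm.++-comm ρ β)) (↭-sym (Perm.shift (suc r) β ρ)))

isPerm-resp-↭ : ∀ {n l l′} → l ↭ l′ → IsPerm n l → IsPerm n l′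
isPerm-resp-↭ p (u , b , s) = PermSetoid.Unique-resp-↭ (setoid ℕ) (↭⇒↭ₛ p) u ,
  b ∘ Perm.∈-resp-↭ (↭-sym p) , Perm.∈-resp-↭ p ∘ s

-- Undoes the contraction: 0 is the contracted point, standing for the values 0, …, suc r.
up : ℕ → ℕ → ℕ
up r zero    = r
up r (suc v) = suc (suc (r + v))

up-injective : ∀ r {v w} → up r v ≡ up r w → v ≡ w
up-injective r {zero} {zero} e = refl
up-injective r {zero} {suc w} e = ⊥-elim (ℕ.m≢1+m+n r {suc w} (trans e (cong suc (sym (ℕ.+-suc r w)))))
up-injective r {suc v} {zero} e = ⊥-elim (ℕ.m≢1+m+n r {suc v} (trans (sym e) (cong suc (sym (ℕ.+-suc r v)))))
up-injective r {suc v} {suc w} e = cong suc (ℕ.+-cancelˡ-≡ r v w (ℕ.suc-injective (ℕ.suc-injective e)))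

up-≥ : ∀ r v → r ≤ up r v
up-≥ r zero = ℕ.≤-refl
up-≥ r (suc v) = ℕ.m≤n⇒m≤1+n (ℕ.m≤n⇒m≤1+n (ℕ.m≤m+n r v))

up-≢ : ∀ r v → up r v ≢ suc r
up-≢ r zero e = ℕ.1+n≢n (sym e)
up-≢ r (suc v) e = ℕ.m≢1+m+n r (sym (ℕ.suc-injective e))

up-surjective : ∀ {r v} → r ≤ v → v ≢ suc r → ∃ λ w → up r w ≡ v
up-surjective {r} p ne with ℕ.m≤n⇒∃[o]m+o≡n p
... | zero , refl = zero , sym (ℕ.+-identityʳ r)
... | suc zero , refl = ⊥-elim (ne (ℕ.+-comm r 1))
... | suc (suc w) , refl = suc w , sym (trans (ℕ.+-suc r (suc w)) (cong suc (ℕ.+-suc r w)))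

up-<⁺ : ∀ r {v m} → v ℕ.< m → up r v ℕ.< suc (r + m)
up-<⁺ r {zero} {m} p = s≤s (ℕ.m≤m+n r m)
up-<⁺ r {suc v} {m} p = s≤s (subst (λ z → z ≤ r + m) (trans (ℕ.+-suc r (suc v)) (cong suc (ℕ.+-suc r v))) (ℕ.+-monoʳ-≤ r p))

up-<⁻ : ∀ r {v m} → 0 ℕ.< m → up r v ℕ.< suc (r + m) → v ℕ.< m
up-<⁻ r {zero} 0<m p = 0<m
up-<⁻ r {suc v} {m} 0<m (s≤s p) =
  ℕ.+-cancelˡ-≤ r _ _ (subst (λ z → z ≤ r + m) (sym (trans (ℕ.+-suc r (suc v)) (cong suc (ℕ.+-suc r v)))) p)

isPerm-glue : ∀ {r m ρ ω} → 0 ℕ.< m → IsPerm r ρ → IsPerm m ω → IsPerm (suc (r + m)) (suc r ∷ ρ ++ map (up r) ω)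
isPerm-glue {r} {m} {ρ} {ω} 0<m (uρ , bρ , sρ) (uω , bω , sω) =
  (All.tabulate fresh ∷ Unique.++⁺ uρ (Unique.map⁺ (up-injective r) uω) disjoint) , bounded , surjective
  where
  fresh : ∀ {v} → v ∈ ρ ++ map (up r) ω → suc r ≢ v
  fresh v∈ refl with ∈-++⁻ ρ v∈
  ... | inj₁ p = ℕ.<-asym (bρ p) ℕ.≤-refl
  ... | inj₂ p with ∈-map⁻ (up r) p
  ... | w , _ , e = up-≢ r w (sym e)
  disjoint : ∀ {v} → ¬ (v ∈ ρ × v ∈ map (up r) ω)
  disjoint (p , q) with ∈-map⁻ (up r) q
  ... | w , _ , refl = ℕ.<⇒≱ (bρ p) (up-≥ r w)
  bounded : ∀ {v} → v ∈ suc r ∷ ρ ++ map (up r) ω → v ℕ.< suc (r + m)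
  -- The value `suc r` is in range because `m` is positive.
  bounded (here refl) = s≤s (subst (λ z → z ≤ r + m) (ℕ.+-comm r 1) (ℕ.+-monoʳ-≤ r 0<m))
  bounded (there v∈) with ∈-++⁻ ρ v∈
  ... | inj₁ p = ℕ.<-≤-trans (bρ p) (ℕ.m≤n⇒m≤1+n (ℕ.m≤m+n r m))
  ... | inj₂ p with ∈-map⁻ (up r) p
  ... | w , w∈ , refl = up-<⁺ r (bω w∈)
  surjective : ∀ {v} → v ℕ.< suc (r + m) → v ∈ suc r ∷ ρ ++ map (up r) ω
  surjective {v} v< with v ℕ.<? r | v ℕ.≟ suc r
  ... | yes v<r | _ = there (∈-++⁺ˡ (sρ v<r))
  ... | no _ | yes refl = here refl
  ... | no v≮r | no ne with up-surjective (ℕ.≮⇒≥ v≮r) ne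
  ... | w , refl = there (∈-++⁺ʳ ρ (∈-map⁺ (up r) (sω (up-<⁻ r 0<m v<))))

isPerm-unglue : ∀ {r m ρ ω} → (∀ {v} → v ∈ ρ → v ℕ.< r) → IsPerm (suc (r + m)) (suc r ∷ ρ ++ map (up r) ω) →
  0 ℕ.< m × IsPerm r ρ × IsPerm m ω
isPerm-unglue {r} {m} {ρ} {ω} low (_ ∷ u , b , s) = 0<m , (uρ , low , sρ) , (uω , bω , sω)
  where
  0<m : 0 ℕ.< m
  -- Conversely, the presence of the value `suc r` forces `m` to be positive.
  0<m = ℕ.+-cancelˡ-≤ r _ _ (subst (λ z → z ≤ r + m) (ℕ.+-comm 1 r) (ℕ.s≤s⁻¹ (b (here refl))))
  uρ : Unique ρ
  uρ = proj₁ (unique-++⁻ ρ u)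
  uω : Unique ω
  uω = Unique.map⁻ (proj₂ (unique-++⁻ ρ u))
  bω : ∀ {v} → v ∈ ω → v ℕ.< m
  bω p = up-<⁻ r 0<m (b (there (∈-++⁺ʳ ρ (∈-map⁺ (up r) p))))
  sρ : ∀ {v} → v ℕ.< r → v ∈ ρ
  sρ {v} v<r with s (ℕ.<-≤-trans v<r (ℕ.m≤n⇒m≤1+n (ℕ.m≤m+n r m)))
  ... | here refl = ⊥-elim (ℕ.<-asym v<r ℕ.≤-refl)
  ... | there q with ∈-++⁻ ρ q
  ... | inj₁ p = p
  ... | inj₂ p with ∈-map⁻ (up r) p
  ... | w , _ , refl = ⊥-elim (ℕ.<⇒≱ v<r (up-≥ r w))
  sω : ∀ {v} → v ℕ.< m → v ∈ ω
  sω {v} v<m with s (up-<⁺ r v<m)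
  ... | here e = ⊥-elim (up-≢ r v e)
  ... | there q with ∈-++⁻ ρ q
  ... | inj₁ p = ⊥-elim (ℕ.<⇒≱ (low p) (up-≥ r v))
  ... | inj₂ p with ∈-map⁻ (up r) p
  ... | w , w∈ , e = subst (_∈ ω) (sym (up-injective r e)) w∈

-- Permutations with more than k occurrences and triples (r, ω, ρ)

module _ (κ : Kind) where

  -- The outer permutation enters through its lift by `up`, whose letter `r` is the contracted
  -- point, so gluing and ungluing share one relation.
  Glued : ∀ {n} → Vec (Fin n) n → ℕ × List ℕ × List ℕ → Set
  Glued π (r , ω , ρ) = ∃ λ α → ∃ λ β → values π ≡ place κ r α β ρ × Fits r α β ρ × map (up r) ω ≡ α ++ r ∷ β

  -- The contracted permutation must contain the contracted point, so it is nonempty.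
  outers : ℕ → List (List ℕ)
  outers zero    = []
  outers (suc m) = Perms (suc m)

  inners : ℕ → ℕ → List (List ℕ)
  inners k r = map values (filterᵇ (λ ρ → occurrences (mesh κ) ρ ≡ᵇ k) (Sn r))

  -- Here `N` is n - 1, so the outer permutation has n - r - 1 = `N ∸ r` points.
  gluings : ℕ → ℕ → ℕ → List (ℕ × List ℕ × List ℕ)
  gluings N k r = map (r ,_) (cartesianProduct (outers (N ∸ r)) (inners k r))

  triples : ℕ → ℕ → List (ℕ × List ℕ × List ℕ)
  triples N k = concatMap (gluings N k) (downFrom (suc N))

  record Triple (N k : ℕ) (t : ℕ × List ℕ × List ℕ) : Set where
    constructor triple
    field
      r≤N   : proj₁ t ≤ N
      0<N∸r : 0 ℕ.< N ∸ proj₁ t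
      outer : IsPerm (N ∸ proj₁ t) (proj₁ (proj₂ t))
      inner : Vec (Fin (proj₁ t)) (proj₁ t)
      inner∈ : inner ∈ Sn (proj₁ t)
      inner≡ : values inner ≡ proj₂ (proj₂ t)
      inner-occ : occurrences (mesh κ) inner ≡ k

  ∈-outers⁺ : ∀ {m ω} → 0 ℕ.< m → IsPerm m ω → ω ∈ outers m
  ∈-outers⁺ {suc m} _ p = ∈-Perms⁺ p

  ∈-outers⁻ : ∀ {m ω} → ω ∈ outers m → 0 ℕ.< m × IsPerm m ω
  ∈-outers⁻ {suc m} p = s≤s z≤n , ∈-Perms⁻ p

  outers-unique : ∀ m → Unique (outers m)
  outers-unique zero = []
  outers-unique (suc m) = Perms-unique (suc m)

  ∈-triples⁺ : ∀ {N k t} → Triple N k t → t ∈ triples N k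
  ∈-triples⁺ {N} {k} {r , ω , ρ} t = ∈-concatMap⁺ (gluings N k) (lose (∈-downFrom⁺ (s≤s r≤N))
      (∈-map⁺ (r ,_) (∈-cartesianProduct⁺ (∈-outers⁺ 0<N∸r outer) (subst (_∈ inners k r) inner≡
        (∈-map⁺ values (∈-filter⁺ _ inner∈ (ℕ.≡⇒≡ᵇ _ _ inner-occ)))))))
    where open Triple t

  ∈-triples⁻ : ∀ N k {t} → t ∈ triples N k → Triple N k t
  ∈-triples⁻ N k t∈ with find (∈-concatMap⁻ (gluings N k) {xs = downFrom (suc N)} t∈)
  ... | r , r∈ , t∈′ with ∈-map⁻ (r ,_) t∈′
  ... | (ω , ρ) , p , refl with ∈-cartesianProduct⁻ (outers (N ∸ r)) (inners k r) p
  ... | ω∈ , ρ∈ with ∈-map⁻ values ρ∈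
  ... | ρ′ , ρ′∈ , refl with ∈-filter⁻ _ {xs = Sn r} ρ′∈
  ... | ρ′∈Sn , occ = record
    { r≤N = ℕ.s≤s⁻¹ (∈-downFrom⁻ r∈) ; 0<N∸r = proj₁ (∈-outers⁻ ω∈) ; outer = proj₂ (∈-outers⁻ ω∈)
    ; inner = ρ′ ; inner∈ = ρ′∈Sn ; inner≡ = refl ; inner-occ = ℕ.≡ᵇ⇒≡ _ _ occ }

  triples-unique : ∀ N k → Unique (triples N k)
  triples-unique N k = concatMap-unique (gluings N k) proj₁ keyed
      (λ r → Unique.map⁺ (cong proj₂) (Unique.cartesianProduct⁺ (outers-unique (N ∸ r))
        (Unique.map⁺ (values-injective _ _) (Unique.filter⁺ _ (Sn-unique r)))))
      (Unique.downFrom⁺ (suc N))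
    where
    keyed : ∀ r {t} → t ∈ gluings N k r → proj₁ t ≡ r
    keyed r t∈ with ∈-map⁻ (r ,_) t∈
    ... | _ , _ , refl = refl

  glued-key : ∀ {n} {π : Vec (Fin n) n} (K : KeyList κ π) {N k r ω ρ} → Triple N k (r , ω , ρ) → Glued π (r , ω , ρ) →
    r ∈ KeyList.keys K × rank (KeyList.keys K) r ≡ k
  glued-key K (triple _ _ _ ρ′ ρ′∈ refl occ) (α , β , e , f , _) =
    KeyList.keys⁺ K (α , β , _ , e , f) , trans (rank≡occurrences κ K ρ′∈ e f) occ

  exceeding : ℕ → (n : ℕ) → List (Vec (Fin n) n)
  exceeding k n = filterᵇ (λ π → k <ᵇ occurrences (mesh κ) π) (Sn n)

  unglue : ∀ {N k} {π : Vec (Fin (suc N)) (suc N)} → π ∈ exceeding k (suc N) → ∃ λ t → Triple N k t × Glued π t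
  unglue {N} {k} {π} p with ∈-filter⁻ _ {xs = Sn (suc N)} p
  ... | π∈ , k<ᵇ with keysOf κ π∈
  -- More than `k` occurrences guarantee a key of rank `k`; this is the occurrence to contract.
  ... | K@(keyList ks len u k⁻ k⁺) with rank-surjective u (subst (k ℕ.<_) (sym len) (ℕ.<ᵇ⇒< _ _ k<ᵇ))
  ... | r , r∈ , rank≡ with k⁻ r∈
  ... | α , β , ρ , e , f with map-preimage (up r) {α ++ r ∷ β} preimage
    where
    preimage : ∀ {v} → v ∈ α ++ r ∷ β → ∃ λ w → up r w ≡ v
    preimage v∈ with ∈-++⁻ α v∈
    ... | inj₁ q = up-surjective (ℕ.<⇒≤ (ℕ.<⇒≤ (Fits.high-α f q))) (ℕ.>⇒≢ (Fits.high-α f q))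
    ... | inj₂ (here refl) = up-surjective ℕ.≤-refl (λ e → ℕ.1+n≢n (sym e))
    ... | inj₂ (there q) = up-surjective (ℕ.<⇒≤ (ℕ.<⇒≤ (Fits.high-β f q))) (ℕ.>⇒≢ (Fits.high-β f q))
  ... | ω , eω with isPerm-resp-↭ (place-↭ κ r α β ρ) (subst (IsPerm (suc N)) e (∈-Sn⁻ π∈))
  ... | perm with ℕ.m≤n⇒∃[o]m+o≡n (ℕ.s≤s⁻¹ (ℕ.<⇒≤ (proj₁ (proj₂ perm) (here refl))))
  ... | m , refl with isPerm-unglue {r} {m} {ρ} {ω} (Fits.low-ρ f)
         (subst (λ z → IsPerm (suc (r + m)) (suc r ∷ ρ ++ z)) (sym eω) perm)
  ... | 0<m , permρ , permω with isPerm⇒Sn permρ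
  ... | ρ′ , ρ′∈ , refl = (r , ω , ρ) , record
      { r≤N = ℕ.m≤m+n r m
      ; 0<N∸r = subst (0 ℕ.<_) (sym (ℕ.m+n∸m≡n r m)) 0<m
      ; outer = subst (λ z → IsPerm z ω) (sym (ℕ.m+n∸m≡n r m)) permω
      ; inner = ρ′ ; inner∈ = ρ′∈ ; inner≡ = refl
      ; inner-occ = trans (sym (rank≡occurrences κ K ρ′∈ e f)) rank≡
      } , α , β , e , f , eω

  glue : ∀ {N k t} → Triple N k t → ∃ λ (π : Vec (Fin (suc N)) (suc N)) → π ∈ exceeding k (suc N) × Glued π t
  -- The outer permutation is cut at its letter 0, the contracted point.
  glue {N} {k} {r , ω , ρ} t@(triple r≤N 0<m outer ρ′ ρ′∈ refl occ) with ∈-∃++ (proj₂ (proj₂ outer) 0<m)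
  ... | α₀ , β₀ , refl with isPerm⇒Sn perm
    where
    α = map (up r) α₀
    β = map (up r) β₀
    perm : IsPerm (suc N) (place κ r α β ρ)
    perm = isPerm-resp-↭ (↭-sym (place-↭ κ r α β ρ)) (subst₂ IsPerm
      (cong suc (ℕ.m+[n∸m]≡n r≤N)) (cong (λ z → suc r ∷ ρ ++ z) (List.map-++ (up r) α₀ (0 ∷ β₀)))
      (isPerm-glue 0<m (∈-Sn⁻ ρ′∈) outer))
  ... | π , π∈ , e = π , ∈-filter⁺ _ π∈ (ℕ.<⇒<ᵇ k<) , glued
    where
    -- The letters of the outer permutation are distinct, so the rest are positive and `up r` sends
    -- them above `suc r`.
    pos : ∀ {v} → v ∈ α₀ ++ β₀ → 0 ℕ.< v
    pos {zero} v∈ = ⊥-elim (Unique.Unique[x∷xs]⇒x∉xs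
      (PermSetoid.Unique-resp-↭ (setoid ℕ) (↭⇒↭ₛ (Perm.shift 0 α₀ β₀)) (proj₁ outer)) v∈)
    pos {suc v} _ = s≤s z≤n
    high : ∀ {v} → 0 ℕ.< v → suc r ℕ.< up r v
    high {suc v} _ = s≤s (s≤s (ℕ.m≤m+n r v))
    high-map : ∀ l → (∀ {v} → v ∈ l → 0 ℕ.< v) → ∀ {v} → v ∈ map (up r) l → suc r ℕ.< v
    high-map l p v∈ with ∈-map⁻ (up r) v∈
    ... | w , w∈ , refl = high (p w∈)
    glued : Glued π (r , ω , ρ)
    glued = map (up r) α₀ , map (up r) β₀ , e ,
      fits (high-map α₀ (pos ∘ ∈-++⁺ˡ)) (high-map β₀ (pos ∘ ∈-++⁺ʳ α₀)) (proj₁ (proj₂ (∈-Sn⁻ ρ′∈))) ,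
      List.map-++ (up r) α₀ (0 ∷ β₀)
    k< : k ℕ.< occurrences (mesh κ) π
    k< = let K = keysOf κ π∈ ; r∈ , rank≡ = glued-key K t glued in
      subst₂ ℕ._<_ rank≡ (KeyList.keys-length K) (rank-< (KeyList.keys-unique K) r∈)

  -- The lift of the outer permutation has a single possible cut at `r`, which recovers both outer
  -- blocks.
  glued-injective : ∀ {n} {π π′ : Vec (Fin n) n} {t} → Glued π t → Glued π′ t → π ≡ π′
  glued-injective {π = π} {π′} (α , β , e , f , eω) (α′ , β′ , e′ , f′ , eω′)
    with split-unique α (trans (sym eω) eω′) (fits-∉α f) (fits-∉α f′)
  ... | refl , refl = values-injective π π′ (trans e (sym e′))

  -- The key has rank `k` in both triples, and ranks are injective, so `r` agrees; the cuts of the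
  -- word then agree as well.
  glued-functional : ∀ {n} {π : Vec (Fin n) n} {N k t t′} → π ∈ Sn n → Triple N k t → Triple N k t′ →
    Glued π t → Glued π t′ → t ≡ t′
  glued-functional {t = r , ω , ρ} {r′ , ω′ , ρ′} π∈ T T′ g@(α , β , e , f , eω) g′@(α′ , β′ , e′ , f′ , eω′)
    with glued-key (keysOf κ π∈) T g | glued-key (keysOf κ π∈) T′ g′
  ... | r∈ , rank≡ | r′∈ , rank′≡
    with rank-injective (KeyList.keys-unique (keysOf κ π∈)) r∈ r′∈ (trans rank≡ (sym rank′≡))
  ... | refl with place-injective κ (trans (sym e) e′) f f′
  ... | refl , refl , refl = cong (λ z → r , z , ρ) (List.map-injective (up-injective r) (trans eω (sym eω′)))

  length-exceeding : ∀ N k → length (exceeding k (suc N)) ≡ length (triples N k)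
  length-exceeding N k = ℕ.≤-antisym
    (length-≤ Glued (Unique.filter⁺ _ (Sn-unique (suc N)))
      (λ p → let t , T , g = unglue p in t , ∈-triples⁺ T , g) (λ {π} {π′} _ _ → glued-injective {π = π} {π′}))
    -- Membership in `Sn` is made part of the relation because `length-≤` gives its injectivity
    -- argument no membership for the target, while `glued-functional` asks for a permutation.
    (length-≤ (λ t π → Glued π t × π ∈ Sn (suc N)) (triples-unique N k)
      (λ p → let π , q , g = glue (∈-triples⁻ N k p) in π , q , g , proj₁ (∈-filter⁻ _ {xs = Sn (suc N)} q))
      (λ p p′ (g , π∈) (g′ , _) → glued-functional π∈ (∈-triples⁻ N k p) (∈-triples⁻ N k p′) g g′))

-- The recurrence for the distribution

Σ< : ℕ → (ℕ → ℕ) → ℕ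
Σ< zero    f = 0
Σ< (suc n) f = f n + Σ< n f

Σ<-cong : ∀ n {f g} → (∀ i → i ℕ.< n → f i ≡ g i) → Σ< n f ≡ Σ< n g
Σ<-cong zero h = refl
Σ<-cong (suc n) h = cong₂ _+_ (h n ℕ.≤-refl) (Σ<-cong n λ i p → h i (ℕ.m≤n⇒m≤1+n p))

length-concatMap-downFrom : {A : Set} (f : ℕ → List A) → ∀ n → length (concatMap f (downFrom n)) ≡ Σ< n (λ i → length (f i))
length-concatMap-downFrom f zero = refl
length-concatMap-downFrom f (suc n) = trans (length-++ (f n)) (cong (length (f n) ℕ.+_) (length-concatMap-downFrom f n))

-- The coefficients of F(x) - 1; the value 0 at 0 excludes the empty outer permutation.
weight : ℕ → ℕ
weight zero    = 0
weight (suc m) = (suc m) !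

conv : (ℕ → ℕ → ℕ) → ℕ → ℕ → ℕ
conv f N k = Σ< (suc N) (λ r → weight (N ∸ r) * f r k)

conv-cong : ∀ f g N k → (∀ r → r ≤ N → f r k ≡ g r k) → conv f N k ≡ conv g N k
conv-cong f g N k h = Σ<-cong (suc N) λ r p → cong (weight (N ∸ r) *_) (h r (ℕ.s≤s⁻¹ p))

length-outers : ∀ κ m → length (outers κ m) ≡ weight m
length-outers κ zero = refl
length-outers κ (suc m) = trans (length-map values (Sn (suc m))) (length-Sn (suc m))

length-triples : ∀ κ N k → length (triples κ N k) ≡ conv (s (mesh κ)) N k
length-triples κ N k = trans (length-concatMap-downFrom (gluings κ N k) (suc N)) (Σ<-cong (suc N) λ r _ → begin
  length (gluings κ N k r)
    ≡⟨ length-map (r ,_) (cartesianProduct (outers κ (N ∸ r)) (inners κ k r)) ⟩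
  length (cartesianProduct (outers κ (N ∸ r)) (inners κ k r))
    ≡⟨ length-cartesianProductWith _,_ (outers κ (N ∸ r)) (inners κ k r) ⟩
  length (outers κ (N ∸ r)) * length (inners κ k r)
    ≡⟨ cong₂ _*_ (length-outers κ (N ∸ r))
         (length-map values (filterᵇ (λ ρ → occurrences (mesh κ) ρ ≡ᵇ k) (Sn r))) ⟩
  weight (N ∸ r) * s (mesh κ) r k ∎)
  where open ≡-Reasoning

indicator : Bool → ℕ
indicator true  = 1
indicator false = 0

length-filterᵇ-+ : {A : Set} (p q r : A → Bool) → (∀ x → indicator (p x) + indicator (q x) ≡ indicator (r x)) →
  ∀ xs → length (filterᵇ p xs) + length (filterᵇ q xs) ≡ length (filterᵇ r xs)
length-filterᵇ-+ p q r h [] = refl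
length-filterᵇ-+ p q r h (x ∷ xs) with p x | q x | r x | h x | length-filterᵇ-+ p q r h xs
... | true  | false | true  | _ | ih = cong suc ih
... | false | true  | true  | _ | ih = trans (ℕ.+-suc _ _) (cong suc ih)
... | false | false | false | _ | ih = ih

length-filterᵇ-true : {A : Set} (xs : List A) → length (filterᵇ (λ _ → true) xs) ≡ length xs
length-filterᵇ-true [] = refl
length-filterᵇ-true (x ∷ xs) = cong suc (length-filterᵇ-true xs)

indicator-zero : ∀ v → indicator (v ≡ᵇ 0) + indicator (0 <ᵇ v) ≡ 1
indicator-zero zero = refl
indicator-zero (suc v) = refl

indicator-suc : ∀ k v → indicator (v ≡ᵇ suc k) + indicator (suc k <ᵇ v) ≡ indicator (k <ᵇ v)
indicator-suc k zero = refl
indicator-suc zero (suc v) = indicator-zero v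
indicator-suc (suc k) (suc v) = indicator-suc k v

-- The `conv` term at k counts permutations with more than k occurrences. Exactly 0 plus more than 0
-- gives all permutations; exactly k + 1 plus more than k + 1 gives more than k.
record Recurrence (f : ℕ → ℕ → ℕ) : Set where
  field
    zero-zero : f 0 0 ≡ 1
    zero-suc  : ∀ k → f 0 (suc k) ≡ 0
    suc-zero  : ∀ N → f (suc N) 0 + conv f N 0 ≡ (suc N) !
    suc-suc   : ∀ N k → f (suc N) (suc k) + conv f N (suc k) ≡ conv f N k

recurrence-resp : ∀ {f g} → (∀ n k → f n k ≡ g n k) → Recurrence f → Recurrence g
recurrence-resp {f} {g} e rec = record
  { zero-zero = trans (sym (e 0 0)) R.zero-zero
  ; zero-suc  = λ k → trans (sym (e 0 (suc k))) (R.zero-suc k)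
  ; suc-zero  = λ N → trans (sym (cong₂ _+_ (e (suc N) 0) (conv-e N 0))) (R.suc-zero N)
  ; suc-suc   = λ N k → trans (sym (cong₂ _+_ (e (suc N) (suc k)) (conv-e N (suc k)))) (trans (R.suc-suc N k) (conv-e N k))
  }
  where
  module R = Recurrence rec
  conv-e : ∀ N k → conv f N k ≡ conv g N k
  conv-e N k = conv-cong f g N k (λ r _ → e r k)

-- Course-of-values induction through the bound `b`, since `conv f N` involves every `f r` with r ≤
-- N.
recurrence-unique : ∀ {f g} → Recurrence f → Recurrence g → ∀ n k → f n k ≡ g n k
recurrence-unique {f} {g} F G n = agree n n ℕ.≤-refl
  where
  module F = Recurrence F
  module G = Recurrence G
  agree : ∀ b n → n ≤ b → ∀ k → f n k ≡ g n k
  agree b zero _ zero = trans F.zero-zero (sym G.zero-zero)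
  agree b zero _ (suc k) = trans (F.zero-suc k) (sym (G.zero-suc k))
  agree (suc b) (suc N) (s≤s p) k = step k
    where
    conv-≡ : ∀ k → conv f N k ≡ conv g N k
    conv-≡ k = conv-cong f g N k (λ r q → agree b r (ℕ.≤-trans q p) k)
    step : ∀ k → f (suc N) k ≡ g (suc N) k
    step zero = ℕ.+-cancelʳ-≡ (conv f N 0) _ _
      (trans (F.suc-zero N) (trans (sym (G.suc-zero N)) (cong (g (suc N) 0 ℕ.+_) (sym (conv-≡ 0)))))
    step (suc k) = ℕ.+-cancelʳ-≡ (conv f N (suc k)) _ _
      (trans (F.suc-suc N k) (trans (conv-≡ k) (trans (sym (G.suc-suc N k))
        (cong (g (suc N) (suc k) ℕ.+_) (sym (conv-≡ (suc k)))))))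

mesh-recurrence : ∀ κ → Recurrence (s (mesh κ))
mesh-recurrence κ = record
  { zero-zero = zero-zero κ
  ; zero-suc  = zero-suc κ
  ; suc-zero  = λ N → begin
      s (mesh κ) (suc N) 0 + conv (s (mesh κ)) N 0        ≡⟨ cong (s (mesh κ) (suc N) 0 ℕ.+_) (exceeding-conv N 0) ⟨
      s (mesh κ) (suc N) 0 + length (exceeding κ 0 (suc N))
        ≡⟨ length-filterᵇ-+ _ _ (λ _ → true) (λ π → indicator-zero (occurrences (mesh κ) π)) (Sn (suc N)) ⟩
      length (filterᵇ (λ _ → true) (Sn (suc N)))          ≡⟨ length-filterᵇ-true (Sn (suc N)) ⟩
      length (Sn (suc N))                                 ≡⟨ length-Sn (suc N) ⟩
      (suc N) !                                           ∎
  ; suc-suc   = λ N k → begin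
      s (mesh κ) (suc N) (suc k) + conv (s (mesh κ)) N (suc k)
        ≡⟨ cong (s (mesh κ) (suc N) (suc k) ℕ.+_) (exceeding-conv N (suc k)) ⟨
      s (mesh κ) (suc N) (suc k) + length (exceeding κ (suc k) (suc N))
        ≡⟨ length-filterᵇ-+ _ _ (λ π → k <ᵇ occurrences (mesh κ) π)
             (λ π → indicator-suc k (occurrences (mesh κ) π)) (Sn (suc N)) ⟩
      length (exceeding κ k (suc N))                      ≡⟨ exceeding-conv N k ⟩
      conv (s (mesh κ)) N k                               ∎
  }
  where
  open ≡-Reasoning
  zero-zero : ∀ κ → s (mesh κ) 0 0 ≡ 1
  zero-zero κ = refl
  zero-suc : ∀ κ k → s (mesh κ) 0 (suc k) ≡ 0
  zero-suc κ k = refl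
  exceeding-conv : ∀ N k → length (exceeding κ k (suc N)) ≡ conv (s (mesh κ)) N k
  exceeding-conv N k = trans (length-exceeding κ N k) (length-triples κ N k)

Rs-recurrence : ∀ i → Recurrence (s (Rs i))
Rs-recurrence = Rs-by-symmetry Recurrence recurrence-resp (mesh-recurrence right) (mesh-recurrence middle)

-- From the recurrence to the generating functions

sumTo-cong : ∀ n {f g} → (∀ i → i ≤ n → f i ≡ g i) → sumTo n f ≡ sumTo n g
sumTo-cong zero h = h 0 ℕ.≤-refl
sumTo-cong (suc n) h = cong₂ _+ℤ_ (sumTo-cong n λ i p → h i (ℕ.m≤n⇒m≤1+n p)) (h (suc n) ℕ.≤-refl)

sumTo-zero : ∀ n {f} → (∀ i → i ≤ n → f i ≡ + 0) → sumTo n f ≡ + 0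
sumTo-zero zero h = h 0 ℕ.≤-refl
sumTo-zero (suc n) h = cong₂ _+ℤ_ (sumTo-zero n λ i p → h i (ℕ.m≤n⇒m≤1+n p)) (h (suc n) ℕ.≤-refl)

sumTo-first : ∀ n {f} → (∀ i → f (suc i) ≡ + 0) → sumTo n f ≡ f 0
sumTo-first zero h = refl
sumTo-first (suc n) h = trans (cong₂ _+ℤ_ (sumTo-first n h) (h n)) (ℤ.+-identityʳ _)

sumTo-+ : ∀ n f g → sumTo n (λ i → f i +ℤ g i) ≡ sumTo n f +ℤ sumTo n g
sumTo-+ zero f g = refl
sumTo-+ (suc n) f g = trans (cong (_+ℤ (f (suc n) +ℤ g (suc n))) (sumTo-+ n f g))
    (interchange (sumTo n f) (sumTo n g) (f (suc n)) (g (suc n)))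
  where
  interchange : ∀ a b c d → (a +ℤ b) +ℤ (c +ℤ d) ≡ (a +ℤ c) +ℤ (b +ℤ d)
  interchange = ℤ-solve

sumTo-neg : ∀ n f → sumTo n (λ i → - f i) ≡ - sumTo n f
sumTo-neg zero f = refl
sumTo-neg (suc n) f = trans (cong (_+ℤ - f (suc n)) (sumTo-neg n f)) (sym (ℤ.neg-distrib-+ (sumTo n f) (f (suc n))))

sumTo-second : ∀ m {f} → f 0 ≡ + 0 → (∀ i → f (suc (suc i)) ≡ + 0) → sumTo (suc m) f ≡ f 1
sumTo-second zero {f} h₀ h = trans (cong (_+ℤ f 1) h₀) (ℤ.+-identityˡ _)
sumTo-second (suc m) h₀ h = trans (cong₂ _+ℤ_ (sumTo-second m h₀ h) (h m)) (ℤ.+-identityʳ _)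

G : PS
G = X ⊗ (Fser ⊕ neg one)

G-suc : ∀ m → G (suc m) ≡ + weight m
G-suc m = trans (sumTo-second m (ℤ.*-zeroˡ (h (suc m))) (λ i → ℤ.*-zeroˡ (h (m ∸ suc i))))
    (trans (ℤ.*-identityˡ _) (F-one m))
  where
  h : PS
  h = Fser ⊕ neg one
  F-one : ∀ m → (Fser ⊕ neg one) m ≡ + weight m
  F-one zero    = refl
  F-one (suc m) = ℤ.+-identityʳ _

⊗-one : ∀ f n → (f ⊗ one) n ≡ f n
⊗-one f zero = ℤ.*-identityʳ (f 0)
⊗-one f (suc n) = trans (cong₂ _+ℤ_ (sumTo-zero n vanish) last) (ℤ.+-identityˡ _)
  where
  vanish : ∀ i → i ≤ n → f i *ℤ one (suc n ∸ i) ≡ + 0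
  vanish i p rewrite ℕ.+-∸-assoc 1 p = ℤ.*-zeroʳ (f i)
  last : f (suc n) *ℤ one (n ∸ n) ≡ f (suc n)
  last rewrite ℕ.n∸n≡0 n = ℤ.*-identityʳ (f (suc n))

⊗-distribˡ-⊕ : ∀ f g h n → (f ⊗ (g ⊕ h)) n ≡ (f ⊗ g) n +ℤ (f ⊗ h) n
⊗-distribˡ-⊕ f g h n = trans (sumTo-cong n λ i _ → ℤ.*-distribˡ-+ (f i) (g (n ∸ i)) (h (n ∸ i))) (sumTo-+ n _ _)

⊗-neg : ∀ f g n → (f ⊗ neg g) n ≡ - (f ⊗ g) n
⊗-neg f g n = trans (sumTo-cong n λ i _ → sym (ℤ.neg-distribʳ-* (f i) (g (n ∸ i)))) (sumTo-neg n _)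

sumTo-+ℕ : ∀ n f → sumTo n (λ i → + f i) ≡ + Σ< (suc n) f
sumTo-+ℕ zero f = cong +_ (sym (ℕ.+-identityʳ (f 0)))
sumTo-+ℕ (suc n) f = trans (cong (_+ℤ + f (suc n)) (sumTo-+ℕ n f)) (cong +_ (ℕ.+-comm (Σ< (suc n) f) (f (suc n))))

column : (ℕ → ℕ → ℕ) → ℕ → PS
column f k n = + f n k

-- Multiplication by `X` makes the constant term of `G` vanish and shifts the weights by one, so
-- only the indices up to `N` contribute.
column-⊗-G : ∀ f k N → (column f k ⊗ G) (suc N) ≡ + conv f N k
column-⊗-G f k N = trans (cong₂ _+ℤ_ (trans (sumTo-cong N term) (sumTo-+ℕ N _)) last) (ℤ.+-identityʳ _)
  where
  term : ∀ i → i ≤ N → + f i k *ℤ G (suc N ∸ i) ≡ + (weight (N ∸ i) * f i k)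
  term i p rewrite ℕ.+-∸-assoc 1 p | G-suc (N ∸ i) =
    trans (sym (ℤ.pos-* (f i k) (weight (N ∸ i)))) (cong +_ (ℕ.*-comm (f i k) (weight (N ∸ i))))
  last : + f (suc N) k *ℤ G (N ∸ N) ≡ + 0
  last rewrite ℕ.n∸n≡0 N = ℤ.*-zeroʳ (+ f (suc N) k)

column-⊗-denomA : ∀ f k n → (column f k ⊗ denomA) n ≡ column f k n +ℤ (column f k ⊗ G) n
column-⊗-denomA f k n = trans (⊗-distribˡ-⊕ (column f k) one G n) (cong (_+ℤ (column f k ⊗ G) n) (⊗-one (column f k) n))

column-zero : ∀ {f} → Recurrence f → ∀ n → (column f 0 ⊗ denomA) n ≡ Fser n
column-zero {f} R zero = trans (ℤ.*-identityʳ (+ f 0 0)) (cong +_ (Recurrence.zero-zero R))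
column-zero {f} R (suc N) = trans (column-⊗-denomA f 0 (suc N))
  (trans (cong (column f 0 (suc N) +ℤ_) (column-⊗-G f 0 N)) (cong +_ (Recurrence.suc-zero R N)))

-- The coefficient of q^(k+1) in F(x,q) times (1 + G) - qG, where the series on the right-hand side,
-- F(x), has no power of q.
column-suc : ∀ {f} → Recurrence f → ∀ k n → (column f k ⊗ neg G) n +ℤ (column f (suc k) ⊗ denomA) n ≡ + 0
column-suc {f} R k zero = cong₂ _+ℤ_ (ℤ.*-zeroʳ (+ f 0 k))
  (trans (ℤ.*-identityʳ (+ f 0 (suc k))) (cong +_ (Recurrence.zero-suc R k)))
column-suc {f} R k (suc N) = trans (cong₂ _+ℤ_
    (trans (⊗-neg (column f k) G (suc N)) (cong -_ (column-⊗-G f k N)))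
    (trans (column-⊗-denomA f (suc k) (suc N)) (trans (cong (column f (suc k) (suc N) +ℤ_) (column-⊗-G f (suc k) N))
      (cong +_ (Recurrence.suc-suc R N k)))))
  (ℤ.+-inverseˡ (+ conv f N k))

1-Q : PS₂
1-Q = lift one ⊕₂ (λ n k → - Q n k)

1-Q-suc : ∀ i j → 1-Q (suc i) j ≡ + 0
1-Q-suc i zero    = refl
1-Q-suc i (suc j) = refl

1-Q-⊗₂-lift : ∀ h n k → (1-Q ⊗₂ lift h) n k ≡ sumTo k (λ j → 1-Q 0 j *ℤ lift h n (k ∸ j))
1-Q-⊗₂-lift h n k = sumTo-first n λ i → sumTo-zero k λ j _ →
  trans (cong (_*ℤ lift h (n ∸ suc i) (k ∸ j)) (1-Q-suc i j)) (ℤ.*-zeroˡ (lift h (n ∸ suc i) (k ∸ j)))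

-- As a polynomial in q the denominator is (1 + G) - qG; this lemma and the next two read off its
-- coefficients.
denomF-0 : ∀ n → denomF n 0 ≡ denomA n
denomF-0 n = cong (one n +ℤ_) (trans (1-Q-⊗₂-lift G n 0) (ℤ.*-identityˡ (G n)))

denomF-1 : ∀ n → denomF n 1 ≡ neg G n
denomF-1 n = trans (ℤ.+-identityˡ _) (trans (1-Q-⊗₂-lift G n 1) (trans (ℤ.+-identityˡ _) (ℤ.-1*i≡-i (G n))))

denomF-2+ : ∀ n k → denomF n (suc (suc k)) ≡ + 0
denomF-2+ n k = trans (ℤ.+-identityˡ _) (trans (1-Q-⊗₂-lift G n (suc (suc k))) (sumTo-zero (suc (suc k)) λ where
  zero          _ → refl
  (suc zero)    _ → refl
  (suc (suc j)) _ → ℤ.*-zeroˡ (lift G n (k ∸ j))))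

-- Multiplication by a polynomial of degree at most 1 in q leaves two terms of the Cauchy product.
sumTo-last-two : ∀ (f h : ℕ → ℤ) → (∀ j → h (suc (suc j)) ≡ + 0) → ∀ k →
  sumTo (suc k) (λ j → f j *ℤ h (suc k ∸ j)) ≡ f k *ℤ h 1 +ℤ f (suc k) *ℤ h 0
sumTo-last-two f h vanish k = cong₂ _+ℤ_ (penultimate k) (cong (λ z → f (suc k) *ℤ h z) (ℕ.n∸n≡0 k))
  where
  vanish′ : ∀ k j → j ≤ k → f j *ℤ h (suc (suc k) ∸ j) ≡ + 0
  vanish′ k j p rewrite ℕ.+-∸-assoc 2 p = trans (cong (f j *ℤ_) (vanish (k ∸ j))) (ℤ.*-zeroʳ (f j))
  penultimate : ∀ k → sumTo k (λ j → f j *ℤ h (suc k ∸ j)) ≡ f k *ℤ h 1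
  penultimate zero = refl
  penultimate (suc k) = trans (cong₂ _+ℤ_ (sumTo-zero k (vanish′ k))
    (cong (λ z → f (suc k) *ℤ h z) (trans (ℕ.+-∸-assoc 1 (ℕ.≤-refl {k})) (cong suc (ℕ.n∸n≡0 k))))) (ℤ.+-identityˡ _)

⊗₂-denomF : ∀ {f} → Recurrence f → ∀ n k → ((λ n k → + f n k) ⊗₂ denomF) n k ≡ lift Fser n k
⊗₂-denomF {f} R n zero = trans (sumTo-cong n λ i _ → cong (+ f i 0 *ℤ_) (denomF-0 (n ∸ i))) (column-zero R n)
⊗₂-denomF {f} R n (suc k) = begin
  sumTo n (λ i → sumTo (suc k) (λ j → + f i j *ℤ denomF (n ∸ i) (suc k ∸ j)))
    ≡⟨ sumTo-cong n (λ i _ → trans (sumTo-last-two (λ j → + f i j) (denomF (n ∸ i)) (denomF-2+ (n ∸ i)) k)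
         (cong₂ (λ x y → + f i k *ℤ x +ℤ + f i (suc k) *ℤ y) (denomF-1 (n ∸ i)) (denomF-0 (n ∸ i)))) ⟩
  sumTo n (λ i → + f i k *ℤ neg G (n ∸ i) +ℤ + f i (suc k) *ℤ denomA (n ∸ i))
    ≡⟨ sumTo-+ n _ _ ⟩
  (column f k ⊗ neg G) n +ℤ (column f (suc k) ⊗ denomA) n
    ≡⟨ column-suc R k n ⟩
  + 0 ∎
  where open ≡-Reasoning

theorem4p1 : ((i j : Fin 8) → Equidistributed (Rs i) (Rs j))
    × ((i : Fin 8) →
    ((n : ℕ) → (Aser (Rs i) ⊗ denomA) n ≡ Fser n)
    × ((n k : ℕ) → (Fq (Rs i) ⊗₂ denomF) n k ≡ lift Fser n k))
theorem4p1 = (λ i j → recurrence-unique (Rs-recurrence i) (Rs-recurrence j)) ,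
  λ i → column-zero (Rs-recurrence i) , ⊗₂-denomF (Rs-recurrence i)
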